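{- Let $d\ge1$ be an integer. If every cosimple zonotope with generators in $\mathbb{Z}^{d-1}$ has covering radius at most $\frac{d-1}{d+1}$, then every cosimple zonotope $Z$ with generators in $\mathbb{Z}^d$ and covering radius $\mu(Z)>\frac{d}{d+2}$ contains at most $\binom{d+2}{2}^d$ points of $\mathbb{Z}^d$.
   Context: A finite collection of vectors $\mathbf u_1,\dots,\mathbf u_n\in\mathbb{Z}^d$ that linearly spans $\mathbb{R}^d$ is called cosimple if there is a linear dependence $\sum_i\lambda_i\mathbf u_i=\mathbf 0$ whose coefficients $\lambda_i$ are all non-zero and have pairwise different absolute values. A cosimple zonotope is a zonotope $\sum_{i=1}^n[\mathbf 0,\mathbf u_i]$ generated by a cosimple collection. The covering radius of a convex body $M\subseteq\mathbb{R}^d$ is $\mu(M)=\min\{\rho>0:\rho M+\mathbb{Z}^d=\mathbb{R}^d\}$. -}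

module Defs where

open import Data.Fin.Base using (Fin)
open import Data.Integer.Base using (ℤ)
open import Data.List.Base using (List; length)
open import Data.List.Relation.Unary.All using (All)
open import Data.List.Relation.Unary.Unique.Propositional using (Unique)
open import Data.Nat.Base as ℕ using (ℕ)
import Data.Nat.Properties as ℕₚ
open import Data.Product.Base using (∃-syntax; _×_; _,_)
open import Data.Rational.Base as ℚ using (ℚ; 0ℚ; 1ℚ; ½; _/_)
import Data.Rational.Properties as ℚₚ
open import Data.Rational.Solver using (module +-*-Solver)
open import Data.Sum.Base using (inj₁; inj₂)
open import Data.Vec.Base using (Vec; lookup)
open import Data.Vec.Functional using (Vector; foldr)
open import Level using (0ℓ)
open import Relation.Binary.PropositionalEquality
  using (_≡_; _≢_; refl; sym; trans; cong; cong₂; subst)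
open import Relation.Nullary using (¬_)
open import Relation.Unary using (Pred; _∈_)

open +-*-Solver using (solve; _:+_; _:*_; :-_; con; _:=_)

------------------------------------------------------------------------
-- Real numbers as Cauchy sequences of rationals, compared up to _≃ℝ_

Eventually : Pred ℕ 0ℓ → Set
Eventually P = ∃[ N ] (∀ n → N ℕ.≤ n → P n)

IsCauchy : (ℕ → ℚ) → Set
IsCauchy x = ∀ ε → 0ℚ ℚ.< ε →
  ∃[ N ] (∀ m n → N ℕ.≤ m → N ℕ.≤ n → ℚ.∣ x m ℚ.- x n ∣ ℚ.≤ ε)

record ℝ : Set where
  constructor mkℝ
  field
    seq    : ℕ → ℚ
    cauchy : IsCauchy seq
open ℝ public

infix  4 _≃ℝ_ _≤ℝ_ _<ℝ_
infixl 6 _+ℝ_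
infixl 7 _*ℝ_

_≃ℝ_ : ℝ → ℝ → Set
x ≃ℝ y = ∀ ε → 0ℚ ℚ.< ε → Eventually λ n → ℚ.∣ seq x n ℚ.- seq y n ∣ ℚ.≤ ε

_≤ℝ_ : ℝ → ℝ → Set
x ≤ℝ y = ∀ ε → 0ℚ ℚ.< ε → Eventually λ n → seq x n ℚ.≤ seq y n ℚ.+ ε

_<ℝ_ : ℝ → ℝ → Set
x <ℝ y = ∃[ ε ] 0ℚ ℚ.< ε × Eventually λ n → seq x n ℚ.+ ε ℚ.≤ seq y n

private
  ½*-pos : ∀ {ε} → 0ℚ ℚ.< ε → 0ℚ ℚ.< ½ ℚ.* ε
  ½*-pos {ε} 0<ε =
    subst (ℚ._< ½ ℚ.* ε) (ℚₚ.*-zeroʳ ½) (ℚₚ.*-monoʳ-<-pos ½ 0<ε)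

  ½+½ : ∀ ε → ½ ℚ.* ε ℚ.+ ½ ℚ.* ε ≡ ε
  ½+½ ε = trans (sym (ℚₚ.*-distribʳ-+ ε ½ ½)) (ℚₚ.*-identityˡ ε)

  *-mono-≤-nonNeg : ∀ {p q r s} → 0ℚ ℚ.≤ p → 0ℚ ℚ.≤ s →
                    p ℚ.≤ q → r ℚ.≤ s → p ℚ.* r ℚ.≤ q ℚ.* s
  *-mono-≤-nonNeg {p} {q} {r} {s} 0≤p 0≤s p≤q r≤s =
    ℚₚ.≤-trans (ℚₚ.*-monoˡ-≤-nonNeg p {{ℚ.nonNegative 0≤p}} r≤s)
               (ℚₚ.*-monoʳ-≤-nonNeg s {{ℚ.nonNegative 0≤s}} p≤q)

  ∣p∣-∣q∣≤∣p-q∣ : ∀ p q → ℚ.∣ p ∣ ℚ.- ℚ.∣ q ∣ ℚ.≤ ℚ.∣ p ℚ.- q ∣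
  ∣p∣-∣q∣≤∣p-q∣ p q = begin
    ℚ.∣ p ∣ ℚ.- ℚ.∣ q ∣
      ≡⟨ cong (λ z → ℚ.∣ z ∣ ℚ.- ℚ.∣ q ∣)
           (solve 2 (λ p q → p := (p :+ :- q) :+ q) refl p q) ⟩
    ℚ.∣ (p ℚ.- q) ℚ.+ q ∣ ℚ.- ℚ.∣ q ∣
      ≤⟨ ℚₚ.+-monoˡ-≤ (ℚ.- ℚ.∣ q ∣) (ℚₚ.∣p+q∣≤∣p∣+∣q∣ (p ℚ.- q) q) ⟩
    (ℚ.∣ p ℚ.- q ∣ ℚ.+ ℚ.∣ q ∣) ℚ.- ℚ.∣ q ∣
      ≡⟨ solve 2 (λ a b → (a :+ b) :+ :- b := a) refl ℚ.∣ p ℚ.- q ∣ ℚ.∣ q ∣ ⟩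
    ℚ.∣ p ℚ.- q ∣ ∎
    where open ℚₚ.≤-Reasoning

  ∣p-q∣≡∣q-p∣ : ∀ p q → ℚ.∣ p ℚ.- q ∣ ≡ ℚ.∣ q ℚ.- p ∣
  ∣p-q∣≡∣q-p∣ p q = trans
    (cong ℚ.∣_∣ (solve 2 (λ p q → p :+ :- q := :- (q :+ :- p)) refl p q))
    (ℚₚ.∣-p∣≡∣p∣ (q ℚ.- p))

  ∣∣p∣-∣q∣∣≤∣p-q∣ : ∀ p q → ℚ.∣ ℚ.∣ p ∣ ℚ.- ℚ.∣ q ∣ ∣ ℚ.≤ ℚ.∣ p ℚ.- q ∣
  ∣∣p∣-∣q∣∣≤∣p-q∣ p q with ℚₚ.∣p∣≡p∨∣p∣≡-p (ℚ.∣ p ∣ ℚ.- ℚ.∣ q ∣)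
  ... | inj₁ eq = ℚₚ.≤-trans (ℚₚ.≤-reflexive eq) (∣p∣-∣q∣≤∣p-q∣ p q)
  ... | inj₂ eq = begin
    ℚ.∣ ℚ.∣ p ∣ ℚ.- ℚ.∣ q ∣ ∣ ≡⟨ eq ⟩
    ℚ.- (ℚ.∣ p ∣ ℚ.- ℚ.∣ q ∣)
      ≡⟨ solve 2 (λ a b → :- (a :+ :- b) := b :+ :- a) refl ℚ.∣ p ∣ ℚ.∣ q ∣ ⟩
    ℚ.∣ q ∣ ℚ.- ℚ.∣ p ∣       ≤⟨ ∣p∣-∣q∣≤∣p-q∣ q p ⟩
    ℚ.∣ q ℚ.- p ∣             ≡⟨ ∣p-q∣≡∣q-p∣ q p ⟩
    ℚ.∣ p ℚ.- q ∣             ∎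
    where open ℚₚ.≤-Reasoning

  eventually-bounded : ∀ x → IsCauchy x →
    ∃[ B ] 0ℚ ℚ.< B × Eventually λ n → ℚ.∣ x n ∣ ℚ.≤ B
  eventually-bounded x cx with cx 1ℚ (ℚₚ.positive⁻¹ 1ℚ)
  ... | N , h = 1ℚ ℚ.+ ℚ.∣ x N ∣ , 0<B , N , bound
    where
    open ℚₚ.≤-Reasoning
    0<B = ℚₚ.+-mono-<-≤ (ℚₚ.positive⁻¹ 1ℚ) (ℚₚ.0≤∣p∣ (x N))
    bound : ∀ n → N ℕ.≤ n → ℚ.∣ x n ∣ ℚ.≤ 1ℚ ℚ.+ ℚ.∣ x N ∣
    bound n N≤n = begin
      ℚ.∣ x n ∣
        ≡⟨ cong ℚ.∣_∣ (solve 2 (λ a b → a := (a :+ :- b) :+ b) refl (x n) (x N)) ⟩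
      ℚ.∣ (x n ℚ.- x N) ℚ.+ x N ∣
        ≤⟨ ℚₚ.∣p+q∣≤∣p∣+∣q∣ (x n ℚ.- x N) (x N) ⟩
      ℚ.∣ x n ℚ.- x N ∣ ℚ.+ ℚ.∣ x N ∣
        ≤⟨ ℚₚ.+-monoˡ-≤ ℚ.∣ x N ∣ (h n N N≤n ℕₚ.≤-refl) ⟩
      1ℚ ℚ.+ ℚ.∣ x N ∣ ∎

  abstract
    +-cauchy : ∀ x y → IsCauchy x → IsCauchy y → IsCauchy (λ n → x n ℚ.+ y n)
    +-cauchy x y cx cy ε 0<ε with cx (½ ℚ.* ε) (½*-pos 0<ε) | cy (½ ℚ.* ε) (½*-pos 0<ε)
    ... | N , h | M , k = N ℕ.⊔ M , bound
      where
      open ℚₚ.≤-Reasoning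
      bound : ∀ m n → N ℕ.⊔ M ℕ.≤ m → N ℕ.⊔ M ℕ.≤ n →
              ℚ.∣ (x m ℚ.+ y m) ℚ.- (x n ℚ.+ y n) ∣ ℚ.≤ ε
      bound m n p q = begin
        ℚ.∣ (x m ℚ.+ y m) ℚ.- (x n ℚ.+ y n) ∣
          ≡⟨ cong ℚ.∣_∣ (solve 4
               (λ a b c d → (a :+ b) :+ :- (c :+ d) := (a :+ :- c) :+ (b :+ :- d))
               refl (x m) (y m) (x n) (y n)) ⟩
        ℚ.∣ (x m ℚ.- x n) ℚ.+ (y m ℚ.- y n) ∣
          ≤⟨ ℚₚ.∣p+q∣≤∣p∣+∣q∣ (x m ℚ.- x n) (y m ℚ.- y n) ⟩
        ℚ.∣ x m ℚ.- x n ∣ ℚ.+ ℚ.∣ y m ℚ.- y n ∣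
          ≤⟨ ℚₚ.+-mono-≤
               (h m n (ℕₚ.m⊔n≤o⇒m≤o N M p) (ℕₚ.m⊔n≤o⇒m≤o N M q))
               (k m n (ℕₚ.m⊔n≤o⇒n≤o N M p) (ℕₚ.m⊔n≤o⇒n≤o N M q)) ⟩
        ½ ℚ.* ε ℚ.+ ½ ℚ.* ε ≡⟨ ½+½ ε ⟩
        ε ∎

  scale : ∀ B C → 0ℚ ℚ.< B ℚ.+ C → ∀ ε → 0ℚ ℚ.< ε →
          ∃[ δ ] 0ℚ ℚ.< δ × B ℚ.* δ ℚ.+ C ℚ.* δ ≡ ε
  scale B C 0<B+C ε 0<ε = rescale (B ℚ.+ C) refl 0<B+C
    where
    open ℚₚ.≤-Reasoning
    rescale : ∀ K → B ℚ.+ C ≡ K → 0ℚ ℚ.< K →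
              ∃[ δ ] 0ℚ ℚ.< δ × B ℚ.* δ ℚ.+ C ℚ.* δ ≡ ε
    rescale K B+C≡K 0<K = δ , 0<δ , eq
      where
      instance
        posK : ℚ.Positive K
        posK = ℚ.positive 0<K
        K≢0 : ℚ.NonZero K
        K≢0 = ℚₚ.pos⇒nonZero K
      δ = (ℚ.1/ K) ℚ.* ε
      0<δ : 0ℚ ℚ.< δ
      0<δ = ℚₚ.positive⁻¹ δ
        {{ℚₚ.pos*pos⇒pos (ℚ.1/ K) {{ℚₚ.1/pos⇒pos K}} ε {{ℚ.positive 0<ε}}}}
      eq : B ℚ.* δ ℚ.+ C ℚ.* δ ≡ ε
      eq = begin-equality
        B ℚ.* δ ℚ.+ C ℚ.* δ      ≡⟨ ℚₚ.*-distribʳ-+ δ B C ⟨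
        (B ℚ.+ C) ℚ.* δ          ≡⟨ cong (ℚ._* δ) B+C≡K ⟩
        K ℚ.* ((ℚ.1/ K) ℚ.* ε)   ≡⟨ ℚₚ.*-assoc K (ℚ.1/ K) ε ⟨
        (K ℚ.* (ℚ.1/ K)) ℚ.* ε   ≡⟨ cong (ℚ._* ε) (ℚₚ.*-inverseʳ K) ⟩
        1ℚ ℚ.* ε                 ≡⟨ ℚₚ.*-identityˡ ε ⟩
        ε                        ∎

  product-difference : ∀ a b c d →
    a ℚ.* b ℚ.- c ℚ.* d ≡ a ℚ.* (b ℚ.- d) ℚ.+ d ℚ.* (a ℚ.- c)
  product-difference = solve 4
    (λ a b c d → a :* b :+ :- (c :* d) := a :* (b :+ :- d) :+ d :* (a :+ :- c))
    refl

  product-estimate : ∀ {a b c d B C δ} → 0ℚ ℚ.≤ δ →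
    ℚ.∣ a ∣ ℚ.≤ B → ℚ.∣ d ∣ ℚ.≤ C →
    ℚ.∣ b ℚ.- d ∣ ℚ.≤ δ → ℚ.∣ a ℚ.- c ∣ ℚ.≤ δ →
    ℚ.∣ a ℚ.* b ℚ.- c ℚ.* d ∣ ℚ.≤ B ℚ.* δ ℚ.+ C ℚ.* δ
  product-estimate {a} {b} {c} {d} {B} {C} {δ} 0≤δ a≤B d≤C b-d≤δ a-c≤δ = begin
    ℚ.∣ a ℚ.* b ℚ.- c ℚ.* d ∣
      ≡⟨ cong ℚ.∣_∣ (product-difference a b c d) ⟩
    ℚ.∣ a ℚ.* (b ℚ.- d) ℚ.+ d ℚ.* (a ℚ.- c) ∣
      ≤⟨ ℚₚ.∣p+q∣≤∣p∣+∣q∣ (a ℚ.* (b ℚ.- d)) (d ℚ.* (a ℚ.- c)) ⟩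
    ℚ.∣ a ℚ.* (b ℚ.- d) ∣ ℚ.+ ℚ.∣ d ℚ.* (a ℚ.- c) ∣
      ≤⟨ ℚₚ.+-mono-≤ (factor a (b ℚ.- d) a≤B b-d≤δ) (factor d (a ℚ.- c) d≤C a-c≤δ) ⟩
    B ℚ.* δ ℚ.+ C ℚ.* δ ∎
    where
    open ℚₚ.≤-Reasoning
    factor : ∀ p q {P} → ℚ.∣ p ∣ ℚ.≤ P → ℚ.∣ q ∣ ℚ.≤ δ → ℚ.∣ p ℚ.* q ∣ ℚ.≤ P ℚ.* δ
    factor p q {P} p≤P q≤δ = subst (ℚ._≤ P ℚ.* δ) (sym (ℚₚ.∣p*q∣≡∣p∣*∣q∣ p q))
      (*-mono-≤-nonNeg {ℚ.∣ p ∣} {P} {ℚ.∣ q ∣} {δ} (ℚₚ.0≤∣p∣ p) 0≤δ p≤P q≤δ)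

  product-cauchy-at : ∀ (x y : ℕ → ℚ) {B C δ ε} → 0ℚ ℚ.< δ → B ℚ.* δ ℚ.+ C ℚ.* δ ≡ ε →
    (Eventually λ n → ℚ.∣ x n ∣ ℚ.≤ B) → (Eventually λ n → ℚ.∣ y n ∣ ℚ.≤ C) →
    ∃[ N ] (∀ m n → N ℕ.≤ m → N ℕ.≤ n → ℚ.∣ x m ℚ.- x n ∣ ℚ.≤ δ) →
    ∃[ N ] (∀ m n → N ℕ.≤ m → N ℕ.≤ n → ℚ.∣ y m ℚ.- y n ∣ ℚ.≤ δ) →
    ∃[ N ] (∀ m n → N ℕ.≤ m → N ℕ.≤ n → ℚ.∣ x m ℚ.* y m ℚ.- x n ℚ.* y n ∣ ℚ.≤ ε)
  product-cauchy-at x y {B} {C} {δ} 0<δ refl (Nx , bx) (Ny , by) (Mx , hx) (My , hy) =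
    N₁ ℕ.⊔ N₂ , bound
    where
    N₁ = Nx ℕ.⊔ Ny
    N₂ = Mx ℕ.⊔ My
    bound : ∀ m n → N₁ ℕ.⊔ N₂ ℕ.≤ m → N₁ ℕ.⊔ N₂ ℕ.≤ n →
            ℚ.∣ x m ℚ.* y m ℚ.- x n ℚ.* y n ∣ ℚ.≤ B ℚ.* δ ℚ.+ C ℚ.* δ
    bound m n p q =
      product-estimate {x m} {y m} {x n} {y n} {B} {C} {δ} (ℚₚ.<⇒≤ 0<δ)
        (bx m (ℕₚ.m⊔n≤o⇒m≤o Nx Ny (ℕₚ.m⊔n≤o⇒m≤o N₁ N₂ p)))
        (by n (ℕₚ.m⊔n≤o⇒n≤o Nx Ny (ℕₚ.m⊔n≤o⇒m≤o N₁ N₂ q)))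
        (hy m n (ℕₚ.m⊔n≤o⇒n≤o Mx My p₂) (ℕₚ.m⊔n≤o⇒n≤o Mx My q₂))
        (hx m n (ℕₚ.m⊔n≤o⇒m≤o Mx My p₂) (ℕₚ.m⊔n≤o⇒m≤o Mx My q₂))
      where
      p₂ = ℕₚ.m⊔n≤o⇒n≤o N₁ N₂ p
      q₂ = ℕₚ.m⊔n≤o⇒n≤o N₁ N₂ q

  abstract
    *-cauchy : ∀ x y → IsCauchy x → IsCauchy y → IsCauchy (λ n → x n ℚ.* y n)
    *-cauchy x y cx cy ε 0<ε = from-bounds (eventually-bounded x cx) (eventually-bounded y cy)
      where
      Goal : Set
      Goal = ∃[ N ] (∀ m n → N ℕ.≤ m → N ℕ.≤ n → ℚ.∣ x m ℚ.* y m ℚ.- x n ℚ.* y n ∣ ℚ.≤ ε)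
      from-δ : ∀ B C → (Eventually λ n → ℚ.∣ x n ∣ ℚ.≤ B) → (Eventually λ n → ℚ.∣ y n ∣ ℚ.≤ C) →
               ∃[ δ ] 0ℚ ℚ.< δ × B ℚ.* δ ℚ.+ C ℚ.* δ ≡ ε → Goal
      from-δ B C bx by (δ , 0<δ , eq) =
        product-cauchy-at x y {B} {C} {δ} {ε} 0<δ eq bx by (cx δ 0<δ) (cy δ 0<δ)
      from-bounds : ∃[ B ] 0ℚ ℚ.< B × (Eventually λ n → ℚ.∣ x n ∣ ℚ.≤ B) →
                    ∃[ C ] 0ℚ ℚ.< C × (Eventually λ n → ℚ.∣ y n ∣ ℚ.≤ C) → Goal
      from-bounds (B , 0<B , bx) (C , 0<C , by) =
        from-δ B C bx by (scale B C (ℚₚ.+-mono-< 0<B 0<C) ε 0<ε)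

    ∣∣-cauchy : ∀ x → IsCauchy x → IsCauchy (λ n → ℚ.∣ x n ∣)
    ∣∣-cauchy x cx ε 0<ε with cx ε 0<ε
    ... | N , h = N , λ m n p q → ℚₚ.≤-trans (∣∣p∣-∣q∣∣≤∣p-q∣ (x m) (x n)) (h m n p q)

    const-cauchy : ∀ q → IsCauchy (λ _ → q)
    const-cauchy q ε 0<ε = 0 , λ _ _ _ _ →
      subst (λ z → ℚ.∣ z ∣ ℚ.≤ ε) (sym (ℚₚ.+-inverseʳ q)) (ℚₚ.<⇒≤ 0<ε)

fromℚ : ℚ → ℝ
fromℚ q = mkℝ (λ _ → q) (const-cauchy q)

fromℤ : ℤ → ℝ
fromℤ z = fromℚ (z / 1)

0ℝ 1ℝ : ℝ
0ℝ = fromℚ 0ℚ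
1ℝ = fromℚ 1ℚ

_+ℝ_ : ℝ → ℝ → ℝ
x +ℝ y = mkℝ (λ n → seq x n ℚ.+ seq y n) (+-cauchy (seq x) (seq y) (cauchy x) (cauchy y))

_*ℝ_ : ℝ → ℝ → ℝ
x *ℝ y = mkℝ (λ n → seq x n ℚ.* seq y n) (*-cauchy (seq x) (seq y) (cauchy x) (cauchy y))

∣_∣ℝ : ℝ → ℝ
∣ x ∣ℝ = mkℝ (λ n → ℚ.∣ seq x n ∣) (∣∣-cauchy (seq x) (cauchy x))

-- The infimum in the usual constructive sense; classically it is the
-- greatest lower bound, and it is the minimum whenever one exists.
IsInfimum : Pred ℝ 0ℓ → ℝ → Set
IsInfimum S r = (∀ s → s ∈ S → r ≤ℝ s)
              × (∀ ε → 0ℝ <ℝ ε → ∃[ s ] s ∈ S × s <ℝ r +ℝ ε)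

------------------------------------------------------------------------
-- ℝᵈ and ℤᵈ

infix  4 _≃ᵛ_
infixl 6 _+ᵛ_
infixr 7 _·ᵛ_

_≃ᵛ_ : ∀ {d} → Vector ℝ d → Vector ℝ d → Set
x ≃ᵛ y = ∀ j → x j ≃ℝ y j

0ᵛ : ∀ {d} → Vector ℝ d
0ᵛ _ = 0ℝ

_+ᵛ_ : ∀ {d} → Vector ℝ d → Vector ℝ d → Vector ℝ d
(x +ᵛ y) j = x j +ℝ y j

_·ᵛ_ : ∀ {d} → ℝ → Vector ℝ d → Vector ℝ d
(c ·ᵛ x) j = c *ℝ x j

-- Lattice points are inductive vectors, so that _≡_ on them is decidable.
ι : ∀ {d} → Vec ℤ d → Vector ℝ d
ι v j = fromℤ (lookup v j)

linComb : ∀ {n d} → Vector ℝ n → Vector (Vec ℤ d) n → Vector ℝ d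
linComb c u = foldr _+ᵛ_ 0ᵛ (λ i → c i ·ᵛ ι (u i))

------------------------------------------------------------------------
-- Cosimple collections, zonotopes, covering radius

Spans : ∀ {n d} → Vector (Vec ℤ d) n → Set
Spans u = ∀ x → ∃[ c ] linComb c u ≃ᵛ x

record Cosimple {n d} (u : Vector (Vec ℤ d) n) : Set where
  field
    spans      : Spans u
    coeff      : Vector ℝ n
    dependence : linComb coeff u ≃ᵛ 0ᵛ
    nonzero    : ∀ i → ¬ (coeff i ≃ℝ 0ℝ)
    distinct   : ∀ i j → i ≢ j → ¬ (∣ coeff i ∣ℝ ≃ℝ ∣ coeff j ∣ℝ)

zonotope : ∀ {n d} → Vector (Vec ℤ d) n → Pred (Vector ℝ d) 0ℓ
zonotope u x = ∃[ t ] (∀ i → 0ℝ ≤ℝ t i × t i ≤ℝ 1ℝ) × x ≃ᵛ linComb t u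

dilate : ∀ {d} → ℝ → Pred (Vector ℝ d) 0ℓ → Pred (Vector ℝ d) 0ℓ
dilate ρ M x = ∃[ y ] y ∈ M × x ≃ᵛ ρ ·ᵛ y

-- M + ℤᵈ = ℝᵈ
CoversByTranslates : ∀ {d} → Pred (Vector ℝ d) 0ℓ → Set
CoversByTranslates M = ∀ x → ∃[ y ] ∃[ z ] y ∈ M × x ≃ᵛ y +ᵛ ι z

-- Taking the infimum instead of the minimum only matters in ℝ⁰, where every
-- ρ > 0 qualifies: there is no minimum and the covering radius is 0.
-- Such a number is unique up to _≃ℝ_, so ∃[ μ ] IsCoveringRadius M μ × μ ≤ℝ c
-- says that the covering radius of M is at most c.
IsCoveringRadius : ∀ {d} → Pred (Vector ℝ d) 0ℓ → ℝ → Set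
IsCoveringRadius M = IsInfimum (λ ρ → 0ℝ <ℝ ρ × CoversByTranslates (dilate ρ M))

AtMost : {A : Set} → ℕ → Pred A 0ℓ → Set
AtMost k P = ∀ xs → Unique xs → All P xs → length xs ℕ.≤ k

{-# OPTIONS --safe #-}

-- Suppose Z contains more than mᵈ lattice points, where m = C(d+2,2).  Two of
-- them, p and q, are congruent modulo m, so p - q = k b with b primitive and
-- k ≥ m.  The projection of Z along b is cosimple, with the same dependence, so
-- by hypothesis its dilates by factors close to (d-1)/(d+1) cover ℝᵈ⁻¹.  Adding
-- 1/m times the segment from q to p, which contains a full period of the
-- lattice in the direction of b, gives a covering of ℝᵈ; by convexity it is
-- contained in a dilate of Z, and hence
--   μ(Z) ≤ (d-1)/(d+1) + 1/m = d/(d+2).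

module Submission where

open import Defs
open import Algebra.Bundles using (CommutativeRing)
import Algebra.Properties.Semiring.Sum as Sum
open import Data.Fin.Base as Fin using (Fin; zero; suc)
import Data.Fin.Properties as Finₚ
open import Data.Integer.Base as ℤ using (ℤ; +_; -[1+_]; 0ℤ; 1ℤ)
import Data.Integer.DivMod as ℤ
import Data.Integer.Properties as ℤₚ
import Data.Integer.Solver as ℤSolver
open import Data.List.Base as List using (List; length; _∷_)
open import Data.List.Membership.Propositional.Properties using (∈-lookup)
open import Data.List.Relation.Unary.All as All using (All)
open import Data.List.Relation.Unary.AllPairs using (_∷_)
open import Data.List.Relation.Unary.Unique.Propositional using (Unique)
open import Data.Nat.Base as ℕ using (ℕ; _+_; _∸_; _^_; _≤_)
open import Data.Nat.Combinatorics using (_C_; nC1≡n; nCk+nC[k+1]≡[n+1]C[k+1])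
open import Data.Nat.Divisibility using (divides)
open import Data.Nat.GCD using (gcd; gcd-GCD; gcd[m,n]∣m; gcd[m,n]∣n; gcd[m,n]≢0; module Bézout)
import Data.Nat.Properties as ℕₚ
import Data.Nat.Solver as ℕSolver
open import Data.Product.Base using (∃-syntax; _×_; _,_; proj₁; proj₂)
open import Data.Rational.Base as ℚ using (ℚ; 0ℚ; 1ℚ; ½; _/_)
import Data.Rational.Properties as ℚₚ
open import Data.Rational.Solver using (module +-*-Solver)
import Data.Rational.Unnormalised.Base as ℚᵘ
import Data.Rational.Unnormalised.Properties as ℚᵘₚ
open import Data.Sum.Base using (inj₁; inj₂)
open import Data.Vec.Base using (Vec; lookup; []; _∷_; tabulate)
open import Data.Vec.Functional using (Vector; head; tail) renaming (_∷_ to infixr 5 _∷ᶠ_)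
open import Data.Vec.Properties using (lookup∘tabulate; tabulate∘lookup; tabulate-cong)
open import Function.Base using (_∘_)
open import Level using (0ℓ)
open import Relation.Binary.PropositionalEquality
  using (_≡_; _≢_; refl; sym; trans; cong; cong₂; subst; subst₂; module ≡-Reasoning)
import Relation.Binary.Reasoning.Setoid as SetoidReasoning
open import Relation.Nullary using (¬_)
open import Relation.Unary using (Pred; _∈_)

-- Unimodular completion of an integer vector

-- Primitivity of b matters because b is then the first column of a unimodular matrix `B`. In the
-- coordinates given by its inverse `A`, the lattice is still the integer lattice and the projection
-- along b forgets the first coordinate, so the hypothesis in dimension d-1 applies to the standard
-- lattice. The value of m is forced by the two bounds: d/(d+2) - (d-1)/(d+1) = 2/((d+1)(d+2)) =
-- 1/m, and m^d is the number of residue classes modulo m. The obstacle is that real numbers are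
-- Cauchy sequences. An infimum need not be attained by a covering factor and the integer part of a
-- real is not computable, so both are replaced by approximations with explicit rational errors,
-- which fit into the ε that `_≤ℝ_` allows. Points of dilates of Z are handled through their
-- coefficient vectors, which turns convexity into interval arithmetic on single coefficients.

module ∑ℤ = Sum ℤₚ.+-*-semiring

-- The Bézout identity is stated for the quotients, not for `a` and `b`. It then makes sense even
-- for a = b = 0, and the quotients always complete to an integer matrix of determinant 1.
record GCDBézout (a b : ℤ) : Set where
  field
    gcdᶻ : ℕ
    a/gcd b/gcd s t : ℤ
    a≡ : a ≡ + gcdᶻ ℤ.* a/gcd
    b≡ : b ≡ + gcdᶻ ℤ.* b/gcd
    bézout : s ℤ.* a/gcd ℤ.+ t ℤ.* b/gcd ≡ 1ℤ

private
  cancel-gcd : ∀ d .{{_ : ℕ.NonZero d}} x m y n →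
               d ℕ.+ y ℕ.* (n ℕ.* d) ≡ x ℕ.* (m ℕ.* d) →
               + x ℤ.* + m ℤ.+ ℤ.- + y ℤ.* + n ≡ 1ℤ
  cancel-gcd d x m y n eq = begin
    + x ℤ.* + m ℤ.+ ℤ.- + y ℤ.* + n          ≡⟨ cong (ℤ._+ ℤ.- + y ℤ.* + n) (ℤₚ.pos-* x m) ⟨
    + (x ℕ.* m) ℤ.+ ℤ.- + y ℤ.* + n
      ≡⟨ cong (λ k → + k ℤ.+ ℤ.- + y ℤ.* + n) (ℕₚ.*-cancelʳ-≡ (1 ℕ.+ y ℕ.* n) (x ℕ.* m) d
           (trans (cong (d ℕ.+_) (ℕₚ.*-assoc y n d)) (trans eq (sym (ℕₚ.*-assoc x m d))))) ⟨
    + (1 ℕ.+ y ℕ.* n) ℤ.+ ℤ.- + y ℤ.* + n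
      ≡⟨ cong (λ k → 1ℤ ℤ.+ k ℤ.+ ℤ.- + y ℤ.* + n) (ℤₚ.pos-* y n) ⟩
    1ℤ ℤ.+ + y ℤ.* + n ℤ.+ ℤ.- + y ℤ.* + n
      ≡⟨ solve 2 (λ y n → con 1ℤ :+ y :* n :+ (:- y) :* n := con 1ℤ) refl (+ y) (+ n) ⟩
    1ℤ                                       ∎
    where
    open ≡-Reasoning
    open ℤSolver.+-*-Solver

gcd-bézout-ℕ : ∀ m n → GCDBézout (+ m) (+ n)
-- Here the gcd is `n`, which may be 0 and then could not be cancelled; in the other clause the gcd
-- is nonzero.
gcd-bézout-ℕ ℕ.zero n = record
  { gcdᶻ = n ; a/gcd = 0ℤ ; b/gcd = 1ℤ ; s = 0ℤ ; t = 1ℤ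
  ; a≡ = sym (ℤₚ.*-zeroʳ (+ n)) ; b≡ = sym (ℤₚ.*-identityʳ (+ n)) ; bézout = refl }
gcd-bézout-ℕ m@(ℕ.suc _) n = build (gcd[m,n]∣m m n) (gcd[m,n]∣n m n) (Bézout.identity (gcd-GCD m n))
  where
  d = gcd m n
  instance d-nonZero = ℕ.≢-nonZero (gcd[m,n]≢0 m n (inj₁ λ ()))
  quotient : ∀ {a q} → a ≡ q ℕ.* d → + a ≡ + d ℤ.* + q
  quotient {q = q} eq = trans (cong +_ (trans eq (ℕₚ.*-comm q d))) (ℤₚ.pos-* d q)
  build : _ → _ → Bézout.Identity d m n → GCDBézout (+ m) (+ n)
  build (divides m′ m≡) (divides n′ n≡) (Bézout.+- x y eq) = record
    { gcdᶻ = d ; a/gcd = + m′ ; b/gcd = + n′ ; s = + x ; t = ℤ.- + y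
    ; a≡ = quotient m≡ ; b≡ = quotient n≡
    ; bézout = cancel-gcd d x m′ y n′ (subst₂ (λ m n → d ℕ.+ y ℕ.* n ≡ x ℕ.* m) m≡ n≡ eq) }
  build (divides m′ m≡) (divides n′ n≡) (Bézout.-+ x y eq) = record
    { gcdᶻ = d ; a/gcd = + m′ ; b/gcd = + n′ ; s = ℤ.- + x ; t = + y
    ; a≡ = quotient m≡ ; b≡ = quotient n≡
    ; bézout = trans (ℤₚ.+-comm (ℤ.- + x ℤ.* + m′) (+ y ℤ.* + n′))
        (cancel-gcd d y n′ x m′ (subst₂ (λ m n → d ℕ.+ x ℕ.* m ≡ y ℕ.* n) m≡ n≡ eq)) }

gcd-bézout : ∀ a n → GCDBézout a (+ n)
gcd-bézout (+ m) n = gcd-bézout-ℕ m n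
gcd-bézout -[1+ m ] n = record
  { gcdᶻ = gcdᶻ ; a/gcd = ℤ.- a/gcd ; b/gcd = b/gcd ; s = ℤ.- s ; t = t
  ; a≡ = trans (cong ℤ.-_ a≡) (ℤₚ.neg-distribʳ-* (+ gcdᶻ) a/gcd) ; b≡ = b≡
  ; bézout = trans (solve 4 (λ s a t b → (:- s) :* (:- a) :+ t :* b := s :* a :+ t :* b)
                     refl s a/gcd t b/gcd) bézout }
  where
  open GCDBézout (gcd-bézout-ℕ (ℕ.suc m) n)
  open ℤSolver.+-*-Solver

δ : ∀ {d} → Fin d → Fin d → ℤ
δ zero    zero    = 1ℤ
δ zero    (suc j) = 0ℤ
δ (suc i) zero    = 0ℤ
δ (suc i) (suc j) = δ i j

Matrix : ℕ → ℕ → Set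
Matrix m n = Fin m → Fin n → ℤ

infixl 7 _⊡_
_⊡_ : ∀ {l m n} → Matrix l m → Matrix m n → Matrix l n
(A ⊡ B) i j = ∑ℤ.sum λ k → A i k ℤ.* B k j

IsIdentity : ∀ {d} → Matrix d d → Set
IsIdentity A = ∀ i j → A i j ≡ δ i j

-- The first column of `B` is the primitive vector in the direction of `w`. The matrix `A` sends it
-- to the first unit vector, so the remaining rows of `A` annihilate it.
record UnimodularCompletion {d} (w : Vector ℤ (ℕ.suc d)) : Set where
  field
    A B      : Matrix (ℕ.suc d) (ℕ.suc d)
    AB≡I     : IsIdentity (A ⊡ B)
    BA≡I     : IsIdentity (B ⊡ A)
    content  : ℕ
    multiple : ∀ i → w i ≡ + content ℤ.* B i zero

sum-zero : ∀ {n} (f : Vector ℤ n) → (∀ k → f k ≡ 0ℤ) → ∑ℤ.sum f ≡ 0ℤ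
sum-zero {n} f f≡0 = trans (∑ℤ.sum-cong-≗ f≡0) (∑ℤ.sum-replicate-zero n)

-- Induction on the dimension: `tail w` is its content times a primitive column, so `w` lies in the
-- plane spanned by the first unit vector and that column, where a Bézout matrix for `head w` and
-- the content finishes the job.
completion : ∀ {d} (w : Vector ℤ (ℕ.suc d)) → UnimodularCompletion w
completion {ℕ.zero} w = case-sign (w zero) refl
  where
  -- The content is a natural number, so the sign of the only entry moves into the 1×1 matrix, which
  -- is its own inverse.
  case-sign : ∀ a → w zero ≡ a → UnimodularCompletion w
  case-sign (+ n) eq = record
    { A = λ _ _ → 1ℤ ; B = λ _ _ → 1ℤ
    ; AB≡I = λ { zero zero → refl } ; BA≡I = λ { zero zero → refl }
    ; content = n
    ; multiple = λ { zero → trans eq (sym (ℤₚ.*-identityʳ (+ n))) } }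
  case-sign -[1+ n ] eq = record
    { A = λ _ _ → ℤ.-1ℤ ; B = λ _ _ → ℤ.-1ℤ
    ; AB≡I = λ { zero zero → refl } ; BA≡I = λ { zero zero → refl }
    ; content = ℕ.suc n
    ; multiple = λ { zero → trans eq (trans (sym (ℤₚ.-1*i≡-i (+ ℕ.suc n))) (ℤₚ.*-comm ℤ.-1ℤ (+ ℕ.suc n))) } }
completion {ℕ.suc d} w = record
  { A = A′ ; B = B′ ; AB≡I = A′B′≡I ; BA≡I = B′A′≡I ; content = gcdᶻ ; multiple = multiple′ }
  where
  open UnimodularCompletion (completion (tail w))
  open GCDBézout (gcd-bézout (head w) content)
  open ℤSolver.+-*-Solver

  -- A′ = E (1 ⊕ A) and B′ = (1 ⊕ B) E⁻¹, where E acts on the first two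
  -- coordinates by the matrix (s t ; -b/gcd a/gcd) of determinant 1.
  row-head row-scale column-head column-scale : Vector ℤ (ℕ.suc (ℕ.suc d))
  row-head     = s     ∷ᶠ ℤ.- b/gcd ∷ᶠ λ _ → 0ℤ
  row-scale    = t     ∷ᶠ a/gcd     ∷ᶠ λ _ → 1ℤ
  column-head  = a/gcd ∷ᶠ ℤ.- t     ∷ᶠ λ _ → 0ℤ
  column-scale = b/gcd ∷ᶠ s         ∷ᶠ λ _ → 1ℤ

  -- `E` mixes the new unit vector with the first row of `A`. Rows 0 and 1 of the product thus both
  -- carry a multiple of that row, and both indices go to `zero`.
  previous : Fin (ℕ.suc (ℕ.suc d)) → Fin (ℕ.suc d)
  previous zero    = zero
  previous (suc i) = i

  A′ B′ : Matrix (ℕ.suc (ℕ.suc d)) (ℕ.suc (ℕ.suc d))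
  A′ i zero    = row-head i
  A′ i (suc k) = row-scale i ℤ.* A (previous i) k
  B′ zero    j = column-head j
  B′ (suc k) j = column-scale j ℤ.* B k (previous j)

  A′B′-entry : ∀ i j → (A′ ⊡ B′) i j ≡
    row-head i ℤ.* column-head j ℤ.+ (row-scale i ℤ.* column-scale j) ℤ.* δ (previous i) (previous j)
  A′B′-entry i j = cong (ℤ._+_ (row-head i ℤ.* column-head j)) (trans
    (∑ℤ.sum-cong-≗ λ k → solve 4 (λ c a e b → (c :* a) :* (e :* b) := (c :* e) :* (a :* b))
      refl (row-scale i) (A (previous i) k) (column-scale j) (B k (previous j)))
    (trans (sym (∑ℤ.*-distribˡ-sum (row-scale i ℤ.* column-scale j)
                  (λ k → A (previous i) k ℤ.* B k (previous j))))
      (cong (row-scale i ℤ.* column-scale j ℤ.*_) (AB≡I (previous i) (previous j)))))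

  E-entry : ∀ i j → row-head i ℤ.* column-head j ℤ.+
    (row-scale i ℤ.* column-scale j) ℤ.* δ (previous i) (previous j) ≡ δ i j
  E-entry zero zero = trans (cong (ℤ._+_ (s ℤ.* a/gcd)) (ℤₚ.*-identityʳ (t ℤ.* b/gcd))) bézout
  E-entry zero (suc zero) = solve 2 (λ s t →
    s :* (:- t) :+ (t :* s) :* con 1ℤ := con 0ℤ) refl s t
  E-entry zero (suc (suc j)) = solve 2 (λ s t →
    s :* con 0ℤ :+ (t :* con 1ℤ) :* con 0ℤ := con 0ℤ) refl s t
  E-entry (suc zero) zero = solve 2 (λ a b →
    (:- b) :* a :+ (a :* b) :* con 1ℤ := con 0ℤ) refl a/gcd b/gcd
  E-entry (suc zero) (suc zero) = trans (solve 4 (λ s t a b →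
    (:- b) :* (:- t) :+ (a :* s) :* con 1ℤ := s :* a :+ t :* b)
    refl s t a/gcd b/gcd) bézout
  E-entry (suc zero) (suc (suc j)) = solve 2 (λ a b →
    (:- b) :* con 0ℤ :+ (a :* con 1ℤ) :* con 0ℤ := con 0ℤ) refl a/gcd b/gcd
  E-entry (suc (suc i)) zero = solve 2 (λ a b →
    con 0ℤ :* a :+ (con 1ℤ :* b) :* con 0ℤ := con 0ℤ) refl a/gcd b/gcd
  E-entry (suc (suc i)) (suc zero) = solve 2 (λ s t →
    con 0ℤ :* (:- t) :+ (con 1ℤ :* s) :* con 0ℤ := con 0ℤ) refl s t
  E-entry (suc (suc i)) (suc (suc j)) = solve 1 (λ x →
    con 0ℤ :* con 0ℤ :+ (con 1ℤ :* con 1ℤ) :* x := x) refl (δ i j)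

  A′B′≡I : IsIdentity (A′ ⊡ B′)
  A′B′≡I i j = trans (A′B′-entry i j) (E-entry i j)

  B′A′≡I : IsIdentity (B′ ⊡ A′)
  B′A′≡I zero zero = trans
    (cong (λ z → a/gcd ℤ.* s ℤ.+ (ℤ.- t ℤ.* ℤ.- b/gcd ℤ.+ z)) (sum-zero {d} _ λ _ → refl))
    (trans (solve 4 (λ s t a b →
      a :* s :+ ((:- t) :* (:- b) :+ con 0ℤ) := s :* a :+ t :* b)
      refl s t a/gcd b/gcd) bézout)
  B′A′≡I zero (suc j) = trans
    (cong (λ z → a/gcd ℤ.* (t ℤ.* A zero j) ℤ.+ (ℤ.- t ℤ.* (a/gcd ℤ.* A zero j) ℤ.+ z))
      (sum-zero {d} _ λ k → ℤₚ.*-zeroˡ (1ℤ ℤ.* A (suc k) j)))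
    (solve 3 (λ t a x →
      a :* (t :* x) :+ ((:- t) :* (a :* x) :+ con 0ℤ) := con 0ℤ)
      refl t a/gcd (A zero j))
  B′A′≡I (suc i) zero = trans
    (cong (λ z → (b/gcd ℤ.* B i zero) ℤ.* s ℤ.+ ((s ℤ.* B i zero) ℤ.* ℤ.- b/gcd ℤ.+ z))
      (sum-zero {d} _ λ k → ℤₚ.*-zeroʳ (1ℤ ℤ.* B i (suc k))))
    (solve 3 (λ s b x →
      (b :* x) :* s :+ ((s :* x) :* (:- b) :+ con 0ℤ) := con 0ℤ)
      refl s b/gcd (B i zero))
  -- The first two summands share the factor `B i zero ℤ.* A zero j`, and their coefficients add up
  -- to 1 by `bézout`; this restores the first summand of `(B ⊡ A) i j`.
  B′A′≡I (suc i) (suc j) = trans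
    (cong (λ z → (b/gcd ℤ.* B i zero) ℤ.* (t ℤ.* A zero j) ℤ.+
                 ((s ℤ.* B i zero) ℤ.* (a/gcd ℤ.* A zero j) ℤ.+ z))
      (∑ℤ.sum-cong-≗ {d} λ k → cong₂ ℤ._*_ (ℤₚ.*-identityˡ (B i (suc k))) (ℤₚ.*-identityˡ (A (suc k) j))))
    (trans (solve 7 (λ s t a b x y z →
        (b :* x) :* (t :* y) :+ ((s :* x) :* (a :* y) :+ z) :=
        (s :* a :+ t :* b) :* (x :* y) :+ z)
        refl s t a/gcd b/gcd (B i zero) (A zero j) rest)
      (trans (cong (λ g → g ℤ.* (B i zero ℤ.* A zero j) ℤ.+ rest) bézout)
        (trans (cong (ℤ._+ rest) (ℤₚ.*-identityˡ (B i zero ℤ.* A zero j))) (BA≡I i j))))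
    where rest = ∑ℤ.sum λ k → B i (suc k) ℤ.* A (suc k) j

  multiple′ : ∀ i → w i ≡ + gcdᶻ ℤ.* B′ i zero
  multiple′ zero    = a≡
  multiple′ (suc i) = trans (multiple i) (trans (cong (ℤ._* B i zero) b≡)
    (ℤₚ.*-assoc (+ gcdᶻ) b/gcd (B i zero)))

-- Lattice points congruent modulo m

[1+n]C2*2≡[1+n]*n : ∀ n → (ℕ.suc n C 2) ℕ.* 2 ≡ ℕ.suc n ℕ.* n
[1+n]C2*2≡[1+n]*n ℕ.zero = refl
[1+n]C2*2≡[1+n]*n (ℕ.suc n) = begin
  (ℕ.suc (ℕ.suc n) C 2) ℕ.* 2                ≡⟨ cong (ℕ._* 2) (nCk+nC[k+1]≡[n+1]C[k+1] (ℕ.suc n) 1) ⟨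
  (ℕ.suc n C 1 ℕ.+ ℕ.suc n C 2) ℕ.* 2        ≡⟨ ℕₚ.*-distribʳ-+ 2 (ℕ.suc n C 1) (ℕ.suc n C 2) ⟩
  (ℕ.suc n C 1) ℕ.* 2 ℕ.+ (ℕ.suc n C 2) ℕ.* 2
    ≡⟨ cong₂ (λ a b → a ℕ.* 2 ℕ.+ b) (nC1≡n (ℕ.suc n)) ([1+n]C2*2≡[1+n]*n n) ⟩
  ℕ.suc n ℕ.* 2 ℕ.+ ℕ.suc n ℕ.* n
    ≡⟨ solve 1 (λ n → (con 1 :+ n) :* con 2 :+ (con 1 :+ n) :* n := (con 2 :+ n) :* (con 1 :+ n)) refl n ⟩
  ℕ.suc (ℕ.suc n) ℕ.* ℕ.suc n                ∎
  where
  open ≡-Reasoning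
  open ℕSolver.+-*-Solver

Unique⇒lookup-≢ : ∀ {A : Set} {xs : List A} → Unique xs →
                  ∀ {i j} → i Fin.< j → List.lookup xs i ≢ List.lookup xs j
Unique⇒lookup-≢ {xs = _ ∷ xs} (x∉xs ∷ _) {zero} {suc j} _ = All.lookup x∉xs (∈-lookup j)
Unique⇒lookup-≢ (_ ∷ xs!) {suc i} {suc j} (ℕ.s<s i<j) = Unique⇒lookup-≢ xs! i<j

module _ (m : ℕ) .{{_ : ℕ.NonZero m}} where

  residue : ∀ {d} → Vec ℤ d → Fin (m ℕ.^ d)
  residue [] = zero
  residue (a ∷ v) = Fin.combine (Fin.fromℕ< (ℤ.n%ℕd<d a m)) (residue v)

  -- For congruent `p` and `q` the remainders cancel, and this is (p - q)/m.
  quotient-difference : ∀ {d} → Vec ℤ d → Vec ℤ d → Vector ℤ d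
  quotient-difference p q j = lookup p j ℤ./ℕ m ℤ.- lookup q j ℤ./ℕ m

  residue-≡ : ∀ {d} (p q : Vec ℤ d) → residue p ≡ residue q → ∀ j →
              lookup p j ≡ lookup q j ℤ.+ + m ℤ.* quotient-difference p q j
  residue-≡ (a ∷ p) (b ∷ q) eq zero = begin
    a                                               ≡⟨ ℤ.a≡a%ℕn+[a/ℕn]*n a m ⟩
    + (a ℤ.%ℕ m) ℤ.+ (a ℤ./ℕ m) ℤ.* + m             ≡⟨ cong (λ r → + r ℤ.+ (a ℤ./ℕ m) ℤ.* + m) same-remainder ⟩
    + (b ℤ.%ℕ m) ℤ.+ (a ℤ./ℕ m) ℤ.* + m
      ≡⟨ solve 4 (λ r a b m → r :+ a :* m := (r :+ b :* m) :+ m :* (a :- b)) refl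
           (+ (b ℤ.%ℕ m)) (a ℤ./ℕ m) (b ℤ./ℕ m) (+ m) ⟩
    + (b ℤ.%ℕ m) ℤ.+ (b ℤ./ℕ m) ℤ.* + m ℤ.+ + m ℤ.* (a ℤ./ℕ m ℤ.- b ℤ./ℕ m)
      ≡⟨ cong (ℤ._+ + m ℤ.* (a ℤ./ℕ m ℤ.- b ℤ./ℕ m)) (ℤ.a≡a%ℕn+[a/ℕn]*n b m) ⟨
    b ℤ.+ + m ℤ.* (a ℤ./ℕ m ℤ.- b ℤ./ℕ m)           ∎
    where
    open ≡-Reasoning
    open ℤSolver.+-*-Solver
    same-remainder : a ℤ.%ℕ m ≡ b ℤ.%ℕ m
    same-remainder = Finₚ.fromℕ<-injective (a ℤ.%ℕ m) (b ℤ.%ℕ m) _ _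
      (Finₚ.combine-injectiveˡ (Fin.fromℕ< (ℤ.n%ℕd<d a m)) (residue p)
        (Fin.fromℕ< (ℤ.n%ℕd<d b m)) (residue q) eq)
  residue-≡ (a ∷ p) (b ∷ q) eq (suc j) = residue-≡ p q
    (Finₚ.combine-injectiveʳ (Fin.fromℕ< (ℤ.n%ℕd<d a m)) (residue p)
      (Fin.fromℕ< (ℤ.n%ℕd<d b m)) (residue q) eq) j

  congruent-pair : ∀ {d} {P : Pred (Vec ℤ d) 0ℓ} xs → Unique xs → All P xs → m ℕ.^ d ℕ.< length xs →
    ∃[ p ] ∃[ q ] P p × P q × p ≢ q × residue p ≡ residue q
  congruent-pair xs xs! Pxs m^d<∣xs∣ =
    let i , j , i<j , eq = Finₚ.pigeonhole m^d<∣xs∣ (λ i → residue (List.lookup xs i))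
    in List.lookup xs i , List.lookup xs j
     , All.lookup Pxs (∈-lookup i) , All.lookup Pxs (∈-lookup j) , Unique⇒lookup-≢ xs! i<j , eq

-- Rational inequalities

open +-*-Solver using (solve; _:+_; _:*_; :-_; con; _:=_)

private variable
  p q r s : ℚ
  P Q : ℕ → Set

p≤q⇒0≤q-p : p ℚ.≤ q → 0ℚ ℚ.≤ q ℚ.- p
p≤q⇒0≤q-p {p} {q} p≤q =
  subst (ℚ._≤ q ℚ.- p) (ℚₚ.+-inverseʳ p) (ℚₚ.+-monoˡ-≤ (ℚ.- p) p≤q)

-- Linear inequalities are proved by writing q - p as a sum of terms known to
-- be nonnegative.
≤-by-difference : q ℚ.- p ≡ r → 0ℚ ℚ.≤ r → p ℚ.≤ q
≤-by-difference {q} {p} refl 0≤r = subst₂ ℚ._≤_ (ℚₚ.+-identityʳ p)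
  (solve 2 (λ p q → p :+ (q :+ :- p) := q) refl p q) (ℚₚ.+-monoʳ-≤ p 0≤r)

0≤+ : 0ℚ ℚ.≤ p → 0ℚ ℚ.≤ q → 0ℚ ℚ.≤ p ℚ.+ q
0≤+ = ℚₚ.+-mono-≤

0≤* : 0ℚ ℚ.≤ p → 0ℚ ℚ.≤ q → 0ℚ ℚ.≤ p ℚ.* q
0≤* {p} {q} 0≤p 0≤q = ℚₚ.nonNegative⁻¹ (p ℚ.* q)
  {{ℚₚ.nonNeg*nonNeg⇒nonNeg p {{ℚ.nonNegative 0≤p}} q {{ℚ.nonNegative 0≤q}}}}

0<* : 0ℚ ℚ.< p → 0ℚ ℚ.< q → 0ℚ ℚ.< p ℚ.* q
0<* {p} {q} 0<p 0<q = ℚₚ.positive⁻¹ (p ℚ.* q)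
  {{ℚₚ.pos*pos⇒pos p {{ℚ.positive 0<p}} q {{ℚ.positive 0<q}}}}

0<½ : 0ℚ ℚ.< ½
0<½ = ℚₚ.positive⁻¹ ½

0≤1 : 0ℚ ℚ.≤ 1ℚ
0≤1 = ℚₚ.nonNegative⁻¹ 1ℚ

½p+½p≡p : ∀ p → ½ ℚ.* p ℚ.+ ½ ℚ.* p ≡ p
½p+½p≡p = solve 1 (λ p → con ½ :* p :+ con ½ :* p := p) refl

positive-divides : 0ℚ ℚ.< p → 0ℚ ℚ.< r → ∃[ q ] 0ℚ ℚ.< q × p ℚ.* q ≡ r
positive-divides {p} {r} 0<p 0<r = (ℚ.1/ p) ℚ.* r ,
  0<* (ℚₚ.positive⁻¹ (ℚ.1/ p) {{ℚₚ.1/pos⇒pos p}}) 0<r ,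
  trans (sym (ℚₚ.*-assoc p (ℚ.1/ p) r))
    (trans (cong (ℚ._* r) (ℚₚ.*-inverseʳ p)) (ℚₚ.*-identityˡ r))
  where
  instance
    p-pos = ℚ.positive 0<p
    p-nonZero = ℚₚ.pos⇒nonZero p

∣p∣≤r⇒p≤r : ∀ p → ℚ.∣ p ∣ ℚ.≤ r → p ℚ.≤ r
∣p∣≤r⇒p≤r p h = ℚₚ.≤-trans (p≤∣p∣ p) h
  where
  p≤∣p∣ : ∀ p → p ℚ.≤ ℚ.∣ p ∣
  p≤∣p∣ p with ℚₚ.≤-total 0ℚ p
  ... | inj₁ 0≤p = ℚₚ.≤-reflexive (sym (ℚₚ.0≤p⇒∣p∣≡p 0≤p))
  ... | inj₂ p≤0 = ℚₚ.≤-trans p≤0 (ℚₚ.0≤∣p∣ p)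

∣p∣≤r⇒-r≤p : ∀ p → ℚ.∣ p ∣ ℚ.≤ r → ℚ.- r ℚ.≤ p
∣p∣≤r⇒-r≤p {r} p h = subst (ℚ.- r ℚ.≤_) (solve 1 (λ p → :- (:- p) := p) refl p)
  (ℚₚ.neg-antimono-≤ (∣p∣≤r⇒p≤r (ℚ.- p) (subst (ℚ._≤ r) (sym (ℚₚ.∣-p∣≡∣p∣ p)) h)))

_∧ᵉ_ : Eventually P → Eventually Q → Eventually λ n → P n × Q n
(N , p) ∧ᵉ (M , q) = N ℕ.⊔ M , λ n N⊔M≤n →
  p n (ℕₚ.m⊔n≤o⇒m≤o N M N⊔M≤n) , q n (ℕₚ.m⊔n≤o⇒n≤o N M N⊔M≤n)

mapᵉ : (∀ n → P n → Q n) → Eventually P → Eventually Q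
mapᵉ f (N , p) = N , λ n N≤n → f n (p n N≤n)

always : (∀ n → P n) → Eventually P
always p = 0 , λ n _ → p n

eventually⇒witness : Eventually P → ∃[ n ] P n
eventually⇒witness (N , p) = N , p N ℕₚ.≤-refl

-- The commutative ring of real numbers

-- Wrapping _≃ℝ_ in a record lets Agda infer the two sides of an equation.
infix 4 _≈_
record _≈_ (x y : ℝ) : Set where
  constructor wrap
  field unwrap : x ≃ℝ y
open _≈_

private variable
  x y z w : ℝ

-- The operations on reals act termwise, so a ring identity between reals reduces to one between
-- rationals, which the solver for ℚ proves.
pointwise : (∀ n → seq x n ≡ seq y n) → x ≈ y
pointwise {x} {y} eq .unwrap ε 0<ε = always λ n →
  subst (λ a → ℚ.∣ a ℚ.- seq y n ∣ ℚ.≤ ε) (sym (eq n))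
    (subst (λ a → ℚ.∣ a ∣ ℚ.≤ ε) (sym (ℚₚ.+-inverseʳ (seq y n))) (ℚₚ.<⇒≤ 0<ε))

≈-refl : x ≈ x
≈-refl = pointwise λ _ → refl

≈-sym : x ≈ y → y ≈ x
≈-sym {x} {y} x≈y .unwrap ε 0<ε = mapᵉ
  (λ n → subst (ℚ._≤ ε) (trans (sym (ℚₚ.∣-p∣≡∣p∣ (seq x n ℚ.- seq y n)))
    (cong ℚ.∣_∣ (solve 2 (λ a b → :- (a :+ :- b) := b :+ :- a) refl (seq x n) (seq y n)))))
  (x≈y .unwrap ε 0<ε)

private
  ∣sum∣≤ε : ∀ {a a₁ a₂ ε} → a ≡ a₁ ℚ.+ a₂ →
            ℚ.∣ a₁ ∣ ℚ.≤ ½ ℚ.* ε × ℚ.∣ a₂ ∣ ℚ.≤ ½ ℚ.* ε → ℚ.∣ a ∣ ℚ.≤ ε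
  ∣sum∣≤ε {a₁ = a₁} {a₂} {ε} eq (h₁ , h₂) =
    subst₂ ℚ._≤_ (cong ℚ.∣_∣ (sym eq)) (½p+½p≡p ε)
      (ℚₚ.≤-trans (ℚₚ.∣p+q∣≤∣p∣+∣q∣ a₁ a₂) (ℚₚ.+-mono-≤ h₁ h₂))

≈-trans : x ≈ y → y ≈ z → x ≈ z
≈-trans {x} {y} {z} x≈y y≈z .unwrap ε 0<ε = mapᵉ
  (λ n → ∣sum∣≤ε {a₁ = seq x n ℚ.- seq y n} {seq y n ℚ.- seq z n} (solve 3 (λ a b c → a :+ :- c := (a :+ :- b) :+ (b :+ :- c)) refl
                   (seq x n) (seq y n) (seq z n)))
  (x≈y .unwrap (½ ℚ.* ε) (0<* 0<½ 0<ε) ∧ᵉ y≈z .unwrap (½ ℚ.* ε) (0<* 0<½ 0<ε))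

+ℝ-cong : x ≈ y → z ≈ w → x +ℝ z ≈ y +ℝ w
+ℝ-cong {x} {y} {z} {w} x≈y z≈w .unwrap ε 0<ε = mapᵉ
  (λ n → ∣sum∣≤ε {a₁ = seq x n ℚ.- seq y n} {seq z n ℚ.- seq w n}
    (solve 4 (λ a b c d → (a :+ c) :+ :- (b :+ d) := (a :+ :- b) :+ (c :+ :- d)) refl
      (seq x n) (seq y n) (seq z n) (seq w n)))
  (x≈y .unwrap (½ ℚ.* ε) (0<* 0<½ 0<ε) ∧ᵉ z≈w .unwrap (½ ℚ.* ε) (0<* 0<½ 0<ε))

eventually-bounded : ∀ x → ∃[ B ] 0ℚ ℚ.< B × Eventually λ n → ℚ.∣ seq x n ∣ ℚ.≤ B
eventually-bounded x with cauchy x 1ℚ (ℚₚ.positive⁻¹ 1ℚ)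
... | N , h = 1ℚ ℚ.+ ℚ.∣ seq x N ∣ , ℚₚ.+-mono-<-≤ (ℚₚ.positive⁻¹ 1ℚ) (ℚₚ.0≤∣p∣ (seq x N)) ,
  N , λ n N≤n → subst (λ a → ℚ.∣ a ∣ ℚ.≤ 1ℚ ℚ.+ ℚ.∣ seq x N ∣)
    (solve 2 (λ a b → (a :+ :- b) :+ b := a) refl (seq x n) (seq x N))
    (ℚₚ.≤-trans (ℚₚ.∣p+q∣≤∣p∣+∣q∣ (seq x n ℚ.- seq x N) (seq x N))
      (ℚₚ.+-monoˡ-≤ ℚ.∣ seq x N ∣ (h n N N≤n ℕₚ.≤-refl)))

private
  ∣ca-cb∣≤ε : ∀ c a b {B δ ε} → 0ℚ ℚ.< B → B ℚ.* δ ≡ ε →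
              ℚ.∣ c ∣ ℚ.≤ B → ℚ.∣ a ℚ.- b ∣ ℚ.≤ δ → ℚ.∣ c ℚ.* a ℚ.- c ℚ.* b ∣ ℚ.≤ ε
  ∣ca-cb∣≤ε c a b {B} {δ} {ε} 0<B Bδ≡ε c≤B a-b≤δ = begin
    ℚ.∣ c ℚ.* a ℚ.- c ℚ.* b ∣
      ≡⟨ cong ℚ.∣_∣ (solve 3 (λ c a b → c :* a :+ :- (c :* b) := c :* (a :+ :- b)) refl c a b) ⟩
    ℚ.∣ c ℚ.* (a ℚ.- b) ∣       ≡⟨ ℚₚ.∣p*q∣≡∣p∣*∣q∣ c (a ℚ.- b) ⟩
    ℚ.∣ c ∣ ℚ.* ℚ.∣ a ℚ.- b ∣
      ≤⟨ ℚₚ.*-monoʳ-≤-nonNeg ℚ.∣ a ℚ.- b ∣ {{ℚₚ.∣-∣-nonNeg (a ℚ.- b)}} c≤B ⟩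
    B ℚ.* ℚ.∣ a ℚ.- b ∣
      ≤⟨ ℚₚ.*-monoˡ-≤-nonNeg B {{ℚ.nonNegative (ℚₚ.<⇒≤ 0<B)}} a-b≤δ ⟩
    B ℚ.* δ                     ≡⟨ Bδ≡ε ⟩
    ε                           ∎
    where open ℚₚ.≤-Reasoning

*ℝ-congˡ : ∀ z → x ≈ y → z *ℝ x ≈ z *ℝ y
*ℝ-congˡ {x} {y} z x≈y .unwrap ε 0<ε =
  let B , 0<B , z≤B = eventually-bounded z
      δ , 0<δ , Bδ≡ε = positive-divides 0<B 0<ε
  in mapᵉ (λ n (c≤B , a-b≤δ) →
       ∣ca-cb∣≤ε (seq z n) (seq x n) (seq y n) 0<B Bδ≡ε c≤B a-b≤δ)
     (z≤B ∧ᵉ x≈y .unwrap δ 0<δ)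

*ℝ-comm : ∀ x y → x *ℝ y ≈ y *ℝ x
*ℝ-comm x y = pointwise λ n → ℚₚ.*-comm (seq x n) (seq y n)

*ℝ-cong : x ≈ y → z ≈ w → x *ℝ z ≈ y *ℝ w
*ℝ-cong {x} {y} {z} {w} x≈y z≈w = ≈-trans (*ℝ-congˡ x z≈w)
  (≈-trans (*ℝ-comm x w) (≈-trans (*ℝ-congˡ w x≈y) (*ℝ-comm w y)))

infix 8 -ℝ_
-- As a multiple by -1, the negative inherits its Cauchy proof from `_*ℝ_`; hence the factors
-- `con (ℚ.- 1ℚ)` in the solver calls.
-ℝ_ : ℝ → ℝ
-ℝ x = fromℚ (ℚ.- 1ℚ) *ℝ x

-ℝ-inverseˡ : ∀ x → -ℝ x +ℝ x ≈ 0ℝ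
-ℝ-inverseˡ x = pointwise λ n →
  solve 1 (λ a → con (ℚ.- 1ℚ) :* a :+ a := con 0ℚ) refl (seq x n)

ℝ-commutativeRing : CommutativeRing 0ℓ 0ℓ
ℝ-commutativeRing = record
  { Carrier = ℝ ; _≈_ = _≈_ ; _+_ = _+ℝ_ ; _*_ = _*ℝ_ ; -_ = -ℝ_ ; 0# = 0ℝ ; 1# = 1ℝ
  ; isCommutativeRing = record
    { isRing = record
      { +-isAbelianGroup = record
        { isGroup = record
          { isMonoid = record
            { isSemigroup = record
              { isMagma = record
                { isEquivalence = record { refl = ≈-refl ; sym = ≈-sym ; trans = ≈-trans }
                ; ∙-cong = +ℝ-cong }
              ; assoc = λ x y z → pointwise λ n → ℚₚ.+-assoc (seq x n) (seq y n) (seq z n) }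
            ; identity = (λ x → pointwise λ n → ℚₚ.+-identityˡ (seq x n))
                       , (λ x → pointwise λ n → ℚₚ.+-identityʳ (seq x n)) }
          ; inverse = -ℝ-inverseˡ , λ x → ≈-trans (+ℝ-comm x (-ℝ x)) (-ℝ-inverseˡ x)
          ; ⁻¹-cong = *ℝ-congˡ (fromℚ (ℚ.- 1ℚ)) }
        ; comm = +ℝ-comm }
      ; *-cong = *ℝ-cong
      ; *-assoc = λ x y z → pointwise λ n → ℚₚ.*-assoc (seq x n) (seq y n) (seq z n)
      ; *-identity = (λ x → pointwise λ n → ℚₚ.*-identityˡ (seq x n))
                   , (λ x → pointwise λ n → ℚₚ.*-identityʳ (seq x n))
      ; distrib = (λ x y z → pointwise λ n → ℚₚ.*-distribˡ-+ (seq x n) (seq y n) (seq z n))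
                , (λ x y z → pointwise λ n → ℚₚ.*-distribʳ-+ (seq x n) (seq y n) (seq z n)) }
    ; *-comm = *ℝ-comm } }
  where
  +ℝ-comm : ∀ x y → x +ℝ y ≈ y +ℝ x
  +ℝ-comm x y = pointwise λ n → ℚₚ.+-comm (seq x n) (seq y n)

-- Real numbers between 0 and a rational bound

infixl 6 _-ℝ_
_-ℝ_ : ℝ → ℝ → ℝ
x -ℝ y = x +ℝ -ℝ y

record Nonneg (x : ℝ) : Set where
  constructor nonneg
  field 0≤ℝ : 0ℝ ≤ℝ x
open Nonneg

Nonneg-resp-≗ : (∀ n → seq x n ≡ seq y n) → Nonneg x → Nonneg y
Nonneg-resp-≗ eq (nonneg h) = nonneg λ ε 0<ε →
  mapᵉ (λ n → subst (λ a → 0ℚ ℚ.≤ a ℚ.+ ε) (eq n)) (h ε 0<ε)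

0≤p⇒Nonneg : 0ℚ ℚ.≤ p → Nonneg (fromℚ p)
0≤p⇒Nonneg 0≤p = nonneg λ ε 0<ε → always λ _ → 0≤+ 0≤p (ℚₚ.<⇒≤ 0<ε)

Nonneg-+ : Nonneg x → Nonneg y → Nonneg (x +ℝ y)
Nonneg-+ {x} {y} (nonneg hx) (nonneg hy) = nonneg λ ε 0<ε → mapᵉ
  (λ n (0≤x , 0≤y) → subst (0ℚ ℚ.≤_)
    (solve 3 (λ a b ε → (a :+ con ½ :* ε) :+ (b :+ con ½ :* ε) := (a :+ b) :+ ε) refl
      (seq x n) (seq y n) ε)
    (0≤+ 0≤x 0≤y))
  (hx (½ ℚ.* ε) (0<* 0<½ 0<ε) ∧ᵉ hy (½ ℚ.* ε) (0<* 0<½ 0<ε))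

-- Unlike `_≤ℝ_`, this bounds the terms themselves without any slack. Weights bounded in this way
-- are nonnegative rationals termwise, so products with them preserve inequalities.
EventuallyWithin : ℚ → ℝ → Set
EventuallyWithin r x = Eventually λ n → 0ℚ ℚ.≤ seq x n × seq x n ℚ.≤ r

-- A point of the segment from x to y, dilated by r: the weights r - s and s have sum r, and no
-- division by r is needed to normalise them.
convex : ℚ → ℝ → ℝ → ℝ → ℝ
convex r s x y = (fromℚ r -ℝ s) *ℝ x +ℝ s *ℝ y

Nonneg-convex : ∀ r s → 0ℚ ℚ.< r → EventuallyWithin r s →
                Nonneg x → Nonneg y → Nonneg (convex r s x y)
Nonneg-convex {x} {y} r s 0<r σ-within (nonneg hx) (nonneg hy) = nonneg λ ε 0<ε →
  -- The weights add up to r, so an error δ in both x and y amounts to r δ in total.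
  let δ , 0<δ , rδ≡ε = positive-divides 0<r 0<ε in mapᵉ
  (λ n ((0≤s , s≤r) , 0≤x , 0≤y) → subst (0ℚ ℚ.≤_)
    (trans (rearrange r (seq s n) (seq x n) (seq y n) δ)
      (cong (seq (convex r s x y) n ℚ.+_) rδ≡ε))
    (0≤+ (0≤* (p≤q⇒0≤q-p s≤r) 0≤x) (0≤* 0≤s 0≤y)))
  (σ-within ∧ᵉ (hx δ 0<δ ∧ᵉ hy δ 0<δ))
  where
  rearrange : ∀ r s x y δ →
    (r ℚ.- s) ℚ.* (x ℚ.+ δ) ℚ.+ s ℚ.* (y ℚ.+ δ) ≡
    (r ℚ.+ ℚ.- 1ℚ ℚ.* s) ℚ.* x ℚ.+ s ℚ.* y ℚ.+ r ℚ.* δ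
  rearrange = solve 5 (λ r s x y δ →
    (r :+ :- s) :* (x :+ δ) :+ s :* (y :+ δ) :=
    (r :+ con (ℚ.- 1ℚ) :* s) :* x :+ s :* y :+ r :* δ) refl

record _∈[0,_] (x : ℝ) (r : ℚ) : Set where
  field
    lower : Nonneg x
    upper : Nonneg (fromℚ r -ℝ x)
open _∈[0,_]

∈[0,]-intro : 0ℝ ≤ℝ x → x ≤ℝ fromℚ r → x ∈[0, r ]
∈[0,]-intro {x} {r} 0≤x x≤r .lower = nonneg 0≤x
∈[0,]-intro {x} {r} 0≤x x≤r .upper = nonneg λ ε 0<ε → mapᵉ
  (λ n x≤r+ε → subst (0ℚ ℚ.≤_)
    (solve 3 (λ r ε x → (r :+ ε) :+ :- x := (r :+ con (ℚ.- 1ℚ) :* x) :+ ε) refl r ε (seq x n))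
    (p≤q⇒0≤q-p x≤r+ε))
  (x≤r ε 0<ε)

∈[0,]-elim : x ∈[0, r ] → 0ℝ ≤ℝ x × x ≤ℝ fromℚ r
∈[0,]-elim {x} {r} h = lower h .0≤ℝ , λ ε 0<ε → mapᵉ
  (λ n → ≤-by-difference
    (solve 3 (λ r ε x → (r :+ ε) :+ :- x := (r :+ con (ℚ.- 1ℚ) :* x) :+ ε) refl r ε (seq x n)))
  (upper h .0≤ℝ ε 0<ε)

-- The upper bound is the lower bound for the complements: r minus the combination of x and y is the
-- same combination of 1 - x and 1 - y.
convex-∈[0,] : ∀ r s → 0ℚ ℚ.< r → EventuallyWithin r s →
               x ∈[0, 1ℚ ] → y ∈[0, 1ℚ ] → convex r s x y ∈[0, r ]
convex-∈[0,] r s 0<r w hx hy .lower = Nonneg-convex r s 0<r w (lower hx) (lower hy)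
convex-∈[0,] {x} {y} r s 0<r w hx hy .upper = Nonneg-resp-≗
  (λ n → solve 4 (λ r s x y →
     (r :+ con (ℚ.- 1ℚ) :* s) :* (con 1ℚ :+ con (ℚ.- 1ℚ) :* x) :+ s :* (con 1ℚ :+ con (ℚ.- 1ℚ) :* y) :=
     r :+ con (ℚ.- 1ℚ) :* ((r :+ con (ℚ.- 1ℚ) :* s) :* x :+ s :* y))
     refl r (seq s n) (seq x n) (seq y n))
  (Nonneg-convex r s 0<r w (upper hx) (upper hy))

-- Applied to every coefficient, this gives the inclusion of r Z + s Z in (r + s) Z.
+-∈[0,] : x ∈[0, r ] → y ∈[0, s ] → (x +ℝ y) ∈[0, r ℚ.+ s ]
+-∈[0,] hx hy .lower = Nonneg-+ (lower hx) (lower hy)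
+-∈[0,] {x} {r} {y} {s} hx hy .upper = Nonneg-resp-≗
  (λ n → solve 4 (λ r s x y →
     (r :+ con (ℚ.- 1ℚ) :* x) :+ (s :+ con (ℚ.- 1ℚ) :* y) :=
     (r :+ s) :+ con (ℚ.- 1ℚ) :* (x :+ y)) refl r s (seq x n) (seq y n))
  (Nonneg-+ (upper hx) (upper hy))

0∈[0,1] : 0ℝ ∈[0, 1ℚ ]
0∈[0,1] .lower = 0≤p⇒Nonneg ℚₚ.≤-refl
0∈[0,1] .upper = Nonneg-resp-≗ {fromℚ 1ℚ} {fromℚ 1ℚ -ℝ 0ℝ} (λ _ → refl) (0≤p⇒Nonneg 0≤1)

scale-∈[0,1] : ∀ c → 0ℚ ℚ.< c → c ℚ.* r ≡ 1ℚ → x ∈[0, r ] → (fromℚ c *ℝ x) ∈[0, 1ℚ ]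
scale-∈[0,1] {r} {x} c 0<c cr≡1 h =
  record { lower = scale (lower h)
         ; upper = Nonneg-resp-≗ (λ n → trans (rearrange c r (seq x n))
             (cong (ℚ._+ ℚ.- 1ℚ ℚ.* (c ℚ.* seq x n)) cr≡1)) (scale (upper h)) }
  where
  scale : Nonneg y → Nonneg (fromℚ c *ℝ y)
  scale {y} (nonneg hy) = nonneg λ ε 0<ε →
    let δ , 0<δ , cδ≡ε = positive-divides 0<c 0<ε in mapᵉ
    (λ n 0≤y → subst (0ℚ ℚ.≤_)
      (trans (ℚₚ.*-distribˡ-+ c (seq y n) δ) (cong (c ℚ.* seq y n ℚ.+_) cδ≡ε))
      (0≤* (ℚₚ.<⇒≤ 0<c) 0≤y))
    (hy δ 0<δ)
  rearrange : ∀ c r x → c ℚ.* (r ℚ.+ ℚ.- 1ℚ ℚ.* x) ≡ c ℚ.* r ℚ.+ ℚ.- 1ℚ ℚ.* (c ℚ.* x)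
  rearrange = solve 3 (λ c r x →
    c :* (r :+ con (ℚ.- 1ℚ) :* x) := c :* r :+ con (ℚ.- 1ℚ) :* (c :* x)) refl

-- Integers inside ℚ and ℝ

toℚᵘ-/ : ∀ a n .{{_ : ℕ.NonZero n}} → ℚ.toℚᵘ (a / n) ℚᵘ.≃ (a ℚᵘ./ n)
toℚᵘ-/ a (ℕ.suc n) = ℚₚ.toℚᵘ-fromℚᵘ (ℚᵘ.mkℚᵘ a n)

/1-+ : ∀ a b → (a ℤ.+ b) / 1 ≡ a / 1 ℚ.+ b / 1
/1-+ a b = ℚₚ.toℚᵘ-injective (begin
  ℚ.toℚᵘ ((a ℤ.+ b) / 1)               ≈⟨ toℚᵘ-/ (a ℤ.+ b) 1 ⟩
  (a ℤ.+ b) ℚᵘ./ 1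
    ≈⟨ ℚᵘ.*≡* (cong (ℤ._* + 1) (sym (cong₂ ℤ._+_ (ℤₚ.*-identityʳ a) (ℤₚ.*-identityʳ b)))) ⟩
  a ℚᵘ./ 1 ℚᵘ.+ b ℚᵘ./ 1               ≈⟨ ℚᵘₚ.+-cong (toℚᵘ-/ a 1) (toℚᵘ-/ b 1) ⟨
  ℚ.toℚᵘ (a / 1) ℚᵘ.+ ℚ.toℚᵘ (b / 1)   ≈⟨ ℚₚ.toℚᵘ-homo-+ (a / 1) (b / 1) ⟨
  ℚ.toℚᵘ (a / 1 ℚ.+ b / 1)             ∎)
  where open ℚᵘₚ.≃-Reasoning

/1-* : ∀ a b → (a ℤ.* b) / 1 ≡ (a / 1) ℚ.* (b / 1)
/1-* a b = ℚₚ.toℚᵘ-injective (begin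
  ℚ.toℚᵘ ((a ℤ.* b) / 1)               ≈⟨ toℚᵘ-/ (a ℤ.* b) 1 ⟩
  (a ℤ.* b) ℚᵘ./ 1                     ≈⟨ ℚᵘ.*≡* refl ⟩
  (a ℚᵘ./ 1) ℚᵘ.* (b ℚᵘ./ 1)             ≈⟨ ℚᵘₚ.*-cong (toℚᵘ-/ a 1) (toℚᵘ-/ b 1) ⟨
  ℚ.toℚᵘ (a / 1) ℚᵘ.* ℚ.toℚᵘ (b / 1)   ≈⟨ ℚₚ.toℚᵘ-homo-* (a / 1) (b / 1) ⟨
  ℚ.toℚᵘ ((a / 1) ℚ.* (b / 1))             ∎)
  where open ℚᵘₚ.≃-Reasoning

a/n*n≡a : ∀ a n .{{_ : ℕ.NonZero n}} → (a / n) ℚ.* (+ n / 1) ≡ a / 1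
a/n*n≡a a n@(ℕ.suc _) = ℚₚ.toℚᵘ-injective (begin
  ℚ.toℚᵘ ((a / n) ℚ.* (+ n / 1))               ≈⟨ ℚₚ.toℚᵘ-homo-* (a / n) (+ n / 1) ⟩
  ℚ.toℚᵘ (a / n) ℚᵘ.* ℚ.toℚᵘ (+ n / 1)     ≈⟨ ℚᵘₚ.*-cong (toℚᵘ-/ a n) (toℚᵘ-/ (+ n) 1) ⟩
  (a ℚᵘ./ n) ℚᵘ.* (+ n ℚᵘ./ 1)
    ≈⟨ ℚᵘ.*≡* (trans (ℤₚ.*-identityʳ (a ℤ.* + n)) (cong (λ k → a ℤ.* + k) (sym (ℕₚ.*-identityʳ n)))) ⟩
  a ℚᵘ./ 1                                 ≈⟨ toℚᵘ-/ a 1 ⟨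
  ℚ.toℚᵘ (a / 1)                           ∎)
  where open ℚᵘₚ.≃-Reasoning

0≤n/1 : ∀ n → 0ℚ ℚ.≤ + n / 1
0≤n/1 n = ℚₚ.nonNegative⁻¹ (+ n / 1) {{ℚₚ.normalize-nonNeg n 1}}

0<n/1 : ∀ n .{{_ : ℕ.NonZero n}} → 0ℚ ℚ.< + n / 1
0<n/1 n = ℚₚ.positive⁻¹ (+ n / 1) {{ℚₚ.normalize-pos n 1}}

rational-floor : ∀ q → ∃[ a ] a / 1 ℚ.≤ q × q ℚ.≤ a / 1 ℚ.+ 1ℚ
rational-floor q = a , lower-bound , upper-bound
  where
  D = ℚ.↧ₙ q
  D′ = + D / 1
  a = ℚ.↥ q ℤ./ℕ D
  m = ℚ.↥ q ℤ.%ℕ D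
  qD : q ℚ.* D′ ≡ + m / 1 ℚ.+ a / 1 ℚ.* D′
  qD = trans (cong (ℚ._* D′) (sym (ℚₚ.↥p/↧p≡p q))) (trans (a/n*n≡a (ℚ.↥ q) D)
    (trans (cong (_/ 1) (ℤ.a≡a%ℕn+[a/ℕn]*n (ℚ.↥ q) D))
      (trans (/1-+ (+ m) (a ℤ.* + D)) (cong (+ m / 1 ℚ.+_) (/1-* a (+ D))))))
  instance D-pos = ℚ.positive (0<n/1 D)
  lower-bound : a / 1 ℚ.≤ q
  lower-bound = ℚₚ.*-cancelʳ-≤-pos D′ (≤-by-difference
    (trans (cong (ℚ._- a / 1 ℚ.* D′) qD) (solve 2 (λ m b → (m :+ b) :+ :- b := m) refl (+ m / 1) (a / 1 ℚ.* D′)))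
    (0≤n/1 m))
  k = D ℕ.∸ m
  k+m : + k / 1 ℚ.+ + m / 1 ≡ D′
  k+m = trans (sym (/1-+ (+ k) (+ m)))
    (cong (λ n → + n / 1) (ℕₚ.m∸n+n≡m (ℕₚ.<⇒≤ (ℤ.n%ℕd<d (ℚ.↥ q) D))))
  upper-bound : q ℚ.≤ a / 1 ℚ.+ 1ℚ
  upper-bound = ℚₚ.*-cancelʳ-≤-pos D′ (≤-by-difference
    (trans (cong (λ e → (a / 1 ℚ.+ 1ℚ) ℚ.* D′ ℚ.- e) qD)
      (trans (solve 3 (λ a D r → (a :+ con 1ℚ) :* D :+ :- (r :+ a :* D) := D :+ :- r) refl
               (a / 1) D′ (+ m / 1))
        (trans (cong (ℚ._- + m / 1) (sym k+m))
          (solve 2 (λ k m → (k :+ m) :+ :- m := k) refl (+ k / 1) (+ m / 1)))))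
    (0≤n/1 k))

-- The exact integer part of a real number is not computable; allowing a
-- remainder slightly above 1 makes it so.
approximate-floor : ∀ x η → 0ℚ ℚ.< η → ∃[ a ] EventuallyWithin (1ℚ ℚ.+ η) (x -ℝ fromℤ a)
approximate-floor x η 0<η =
  let N , close = cauchy x (½ ℚ.* η) (0<* 0<½ 0<η)
      -- All later terms are within η/2 of `seq x N`. Shifting down by η/2 before rounding keeps
      -- them above `a`; the shift and the variation together add η to the rounding loss of at most
      -- 1.
      a , a≤ , ≤a+1 = rational-floor (seq x N ℚ.- ½ ℚ.* η)
  in a , N , λ n N≤n →
    let x-xN≤ = close n N N≤n ℕₚ.≤-refl
        0≤₁ = p≤q⇒0≤q-p (∣p∣≤r⇒-r≤p (seq x n ℚ.- seq x N) x-xN≤)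
        0≤₂ = p≤q⇒0≤q-p (∣p∣≤r⇒p≤r (seq x n ℚ.- seq x N) x-xN≤)
    in subst (0ℚ ℚ.≤_)
         (solve 4 (λ x xN a η → (x :+ :- xN :+ :- (:- (con ½ :* η))) :+ (xN :+ :- (con ½ :* η) :+ :- a)
            := x :+ con (ℚ.- 1ℚ) :* a) refl (seq x n) (seq x N) (a / 1) η)
         (0≤+ 0≤₁ (p≤q⇒0≤q-p a≤))
     , ≤-by-difference
         (solve 4 (λ x xN a η → con 1ℚ :+ η :+ :- (x :+ con (ℚ.- 1ℚ) :* a) :=
            (con ½ :* η :+ :- (x :+ :- xN)) :+ (a :+ con 1ℚ :+ :- (xN :+ :- (con ½ :* η))))
            refl (seq x n) (seq x N) (a / 1) η)
         (0≤+ 0≤₂ (p≤q⇒0≤q-p ≤a+1))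

-- Integer matrices acting on ℝᵈ

module ℝ-Ring = CommutativeRing ℝ-commutativeRing
module ∑ℝ = Sum ℝ-Ring.semiring

fromℤ-+ : ∀ a b → fromℤ (a ℤ.+ b) ≈ fromℤ a +ℝ fromℤ b
fromℤ-+ a b = pointwise λ _ → /1-+ a b

fromℤ-* : ∀ a b → fromℤ (a ℤ.* b) ≈ fromℤ a *ℝ fromℤ b
fromℤ-* a b = pointwise λ _ → /1-* a b

fromℤ-sum : ∀ {n} (f : Vector ℤ n) → fromℤ (∑ℤ.sum f) ≈ ∑ℝ.sum (fromℤ ∘ f)
fromℤ-sum {ℕ.zero}  f = ≈-refl
fromℤ-sum {ℕ.suc n} f = ≈-trans (fromℤ-+ (f zero) (∑ℤ.sum (f ∘ suc)))
  (+ℝ-cong ≈-refl (fromℤ-sum (f ∘ suc)))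

infixr 7 _⊛_
_⊛_ : ∀ {m n} → Matrix m n → Vector ℝ n → Vector ℝ m
(A ⊛ x) i = ∑ℝ.sum λ j → fromℤ (A i j) *ℝ x j

module _ {m n} (A : Matrix m n) where

  ⊛-cong : ∀ {x y} → (∀ j → x j ≈ y j) → ∀ i → (A ⊛ x) i ≈ (A ⊛ y) i
  ⊛-cong x≈y i = ∑ℝ.sum-cong-≋ λ j → *ℝ-congˡ (fromℤ (A i j)) (x≈y j)

  ⊛-+ : ∀ x y i → (A ⊛ (x +ᵛ y)) i ≈ (A ⊛ x) i +ℝ (A ⊛ y) i
  ⊛-+ x y i = ≈-trans
    (∑ℝ.sum-cong-≋ λ j → ℝ-Ring.distribˡ (fromℤ (A i j)) (x j) (y j))
    (∑ℝ.∑-distrib-+ (λ j → fromℤ (A i j) *ℝ x j) (λ j → fromℤ (A i j) *ℝ y j))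

  ⊛-· : ∀ c x i → (A ⊛ (c ·ᵛ x)) i ≈ c *ℝ (A ⊛ x) i
  ⊛-· c x i = ≈-trans
    (∑ℝ.sum-cong-≋ λ j → pointwise λ k →
      solve 3 (λ a c x → a :* (c :* x) := c :* (a :* x)) refl
        (seq (fromℤ (A i j)) k) (seq c k) (seq (x j) k))
    (≈-sym (∑ℝ.*-distribˡ-sum c (λ j → fromℤ (A i j) *ℝ x j)))

  ⊛-zero : ∀ i → (A ⊛ 0ᵛ) i ≈ 0ℝ
  ⊛-zero i = ≈-trans
    (∑ℝ.sum-cong-≋ {n} {λ j → fromℤ (A i j) *ℝ 0ℝ} {λ _ → 0ℝ} λ j → ℝ-Ring.zeroʳ (fromℤ (A i j)))
    (∑ℝ.sum-replicate-zero n)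

  ⊛-fromℤ : ∀ z i → (A ⊛ (fromℤ ∘ z)) i ≈ fromℤ (∑ℤ.sum λ j → A i j ℤ.* z j)
  ⊛-fromℤ z i = ≈-trans
    (∑ℝ.sum-cong-≋ λ j → ≈-sym (fromℤ-* (A i j) (z j)))
    (≈-sym (fromℤ-sum λ j → A i j ℤ.* z j))

⊛-assoc : ∀ {l m n} (A : Matrix l m) (B : Matrix m n) x i → (A ⊛ (B ⊛ x)) i ≈ ((A ⊡ B) ⊛ x) i
⊛-assoc A B x i = begin
  (∑ℝ.sum λ j → fromℤ (A i j) *ℝ ∑ℝ.sum λ k → fromℤ (B j k) *ℝ x k)
    ≈⟨ ∑ℝ.sum-cong-≋ (λ j → ∑ℝ.*-distribˡ-sum (fromℤ (A i j)) (λ k → fromℤ (B j k) *ℝ x k)) ⟩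
  (∑ℝ.sum λ j → ∑ℝ.sum λ k → fromℤ (A i j) *ℝ (fromℤ (B j k) *ℝ x k))
    ≈⟨ ∑ℝ.∑-comm (λ j k → fromℤ (A i j) *ℝ (fromℤ (B j k) *ℝ x k)) ⟩
  (∑ℝ.sum λ k → ∑ℝ.sum λ j → fromℤ (A i j) *ℝ (fromℤ (B j k) *ℝ x k))
    ≈⟨ ∑ℝ.sum-cong-≋ (λ k → collect k) ⟩
  (∑ℝ.sum λ k → fromℤ (∑ℤ.sum λ j → A i j ℤ.* B j k) *ℝ x k) ∎
  where
  open SetoidReasoning ℝ-Ring.setoid
  collect : ∀ k → (∑ℝ.sum λ j → fromℤ (A i j) *ℝ (fromℤ (B j k) *ℝ x k)) ≈
                  fromℤ (∑ℤ.sum λ j → A i j ℤ.* B j k) *ℝ x k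
  collect k = begin
    (∑ℝ.sum λ j → fromℤ (A i j) *ℝ (fromℤ (B j k) *ℝ x k))
      ≈⟨ ∑ℝ.sum-cong-≋ (λ j → ≈-trans (≈-sym (ℝ-Ring.*-assoc (fromℤ (A i j)) (fromℤ (B j k)) (x k)))
           (*ℝ-cong (≈-sym (fromℤ-* (A i j) (B j k))) ≈-refl)) ⟩
    (∑ℝ.sum λ j → fromℤ (A i j ℤ.* B j k) *ℝ x k)
      ≈⟨ ∑ℝ.*-distribʳ-sum (x k) (λ j → fromℤ (A i j ℤ.* B j k)) ⟨
    (∑ℝ.sum λ j → fromℤ (A i j ℤ.* B j k)) *ℝ x k
      ≈⟨ *ℝ-cong (≈-sym (fromℤ-sum λ j → A i j ℤ.* B j k)) ≈-refl ⟩
    fromℤ (∑ℤ.sum λ j → A i j ℤ.* B j k) *ℝ x k ∎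

δ-⊛ : ∀ {d} (x : Vector ℝ d) i → (δ ⊛ x) i ≈ x i
δ-⊛ {ℕ.suc d} x zero = ≈-trans
  (+ℝ-cong (ℝ-Ring.*-identityˡ (x zero))
    (≈-trans (∑ℝ.sum-cong-≋ λ j → ℝ-Ring.zeroˡ (x (suc j))) (∑ℝ.sum-replicate-zero d)))
  (ℝ-Ring.+-identityʳ (x zero))
δ-⊛ {ℕ.suc d} x (suc i) = ≈-trans
  (+ℝ-cong (ℝ-Ring.zeroˡ (x zero)) (δ-⊛ (x ∘ suc) i))
  (ℝ-Ring.+-identityˡ (x (suc i)))

inverse-⊛ : ∀ {d} (A B : Matrix d d) → IsIdentity (A ⊡ B) → ∀ x i → (A ⊛ (B ⊛ x)) i ≈ x i
inverse-⊛ A B AB≡I x i = ≈-trans (⊛-assoc A B x i) (≈-trans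
  (∑ℝ.sum-cong-≋ λ j → pointwise λ n → cong (λ a → seq (fromℤ a *ℝ x j) n) (AB≡I i j))
  (δ-⊛ x i))

-- Linear combinations as matrix products, and projections

columns : ∀ {n d} → Vector (Vec ℤ d) n → Matrix d n
columns u j i = lookup (u i) j

-- In this form, linearity in the coefficients comes from the matrix action, and compatibility with
-- integer linear maps is associativity.
linComb≈columns⊛ : ∀ {n d} c (u : Vector (Vec ℤ d) n) j → linComb c u j ≈ (columns u ⊛ c) j
linComb≈columns⊛ {ℕ.zero}  c u j = ≈-refl
linComb≈columns⊛ {ℕ.suc n} c u j = +ℝ-cong (*ℝ-comm (c zero) (fromℤ (lookup (u zero) j)))
  (linComb≈columns⊛ (c ∘ suc) (u ∘ suc) j)

image : ∀ {n d e} → Matrix e d → Vector (Vec ℤ d) n → Vector (Vec ℤ e) n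
image A u i = tabulate λ k → ∑ℤ.sum λ j → A k j ℤ.* lookup (u i) j

linComb-image : ∀ {n d e} (A : Matrix e d) c (u : Vector (Vec ℤ d) n) k →
                linComb c (image A u) k ≈ (A ⊛ linComb c u) k
linComb-image A c u k = begin
  linComb c (image A u) k       ≈⟨ linComb≈columns⊛ c (image A u) k ⟩
  (columns (image A u) ⊛ c) k
    ≈⟨ ∑ℝ.sum-cong-≋ (λ i → pointwise λ n → cong (λ a → seq (fromℤ a *ℝ c i) n)
         (lookup∘tabulate (λ k → ∑ℤ.sum λ j → A k j ℤ.* lookup (u i) j) k)) ⟩
  ((A ⊡ columns u) ⊛ c) k       ≈⟨ ⊛-assoc A (columns u) c k ⟨
  (A ⊛ (columns u ⊛ c)) k       ≈⟨ ⊛-cong A (λ j → linComb≈columns⊛ c u j) k ⟨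
  (A ⊛ linComb c u) k           ∎
  where open SetoidReasoning ℝ-Ring.setoid

linComb-image-≃ : ∀ {n d e} (A : Matrix e d) c (u : Vector (Vec ℤ d) n) x →
                  linComb c u ≃ᵛ x → ∀ k → linComb c (image A u) k ≈ (A ⊛ x) k
linComb-image-≃ A c u x c-x k =
  ≈-trans (linComb-image A c u k) (⊛-cong A {linComb c u} {x} (λ j → wrap (c-x j)) k)

linComb-+ : ∀ {n d} c e (u : Vector (Vec ℤ d) n) j →
            linComb (c +ᵛ e) u j ≈ linComb c u j +ℝ linComb e u j
linComb-+ c e u j = ≈-trans (linComb≈columns⊛ (c +ᵛ e) u j)
  (≈-trans (⊛-+ (columns u) c e j)
    (≈-sym (+ℝ-cong (linComb≈columns⊛ c u j) (linComb≈columns⊛ e u j))))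

linComb-· : ∀ {n d} a c (u : Vector (Vec ℤ d) n) j →
            linComb (a ·ᵛ c) u j ≈ a *ℝ linComb c u j
linComb-· a c u j = ≈-trans (linComb≈columns⊛ (a ·ᵛ c) u j)
  (≈-trans (⊛-· (columns u) a c j) (*ℝ-congˡ a (≈-sym (linComb≈columns⊛ c u j))))

projection : ∀ {n d} → Matrix (ℕ.suc d) (ℕ.suc d) → Vector (Vec ℤ (ℕ.suc d)) n → Vector (Vec ℤ d) n
projection A = image (A ∘ suc)

-- The family keeps its index set, even if generators become zero or coincide, so the conditions on
-- the coefficients carry over verbatim; only spanning needs an argument.
projection-cosimple : ∀ {n d} (A B : Matrix (ℕ.suc d) (ℕ.suc d)) → IsIdentity (A ⊡ B) →
  ∀ {u : Vector (Vec ℤ (ℕ.suc d)) n} → Cosimple u → Cosimple (projection A u)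
projection-cosimple {d = d} A B AB≡I {u} cosimple = record
  { spans = λ y →
      -- `B ⊛ y⁺` is a preimage of `y` under the projection.
      let y⁺ = 0ℝ ∷ᶠ y
          c , c-y⁺ = spans (B ⊛ y⁺)
      in c , λ k → unwrap (≈-trans (linComb-image-≃ (A ∘ suc) c u (B ⊛ y⁺) c-y⁺ k)
           (inverse-⊛ A B AB≡I y⁺ (suc k)))
  ; coeff = coeff
  ; dependence = λ k → unwrap (≈-trans (linComb-image-≃ (A ∘ suc) coeff u 0ᵛ dependence k)
      (⊛-zero (A ∘ suc) k))
  ; nonzero = nonzero
  ; distinct = distinct }
  where
  open Cosimple cosimple
  open _≈_

-- Coverings

linComb-convex : ∀ {n d} r s c e (u : Vector (Vec ℤ d) n) j →
  linComb (λ i → convex r s (c i) (e i)) u j ≈ convex r s (linComb c u j) (linComb e u j)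
linComb-convex r s c e u j = ≈-trans (linComb-+ ((fromℚ r -ℝ s) ·ᵛ c) (s ·ᵛ e) u j)
  (+ℝ-cong (linComb-· (fromℚ r -ℝ s) c u j) (linComb-· s e u j))

linComb-zero : ∀ {n d} (u : Vector (Vec ℤ d) n) j → linComb 0ᵛ u j ≈ 0ℝ
linComb-zero u j = ≈-trans (linComb≈columns⊛ 0ᵛ u j) (⊛-zero (columns u) j)

covers-by-boxes : ∀ {n d} (u : Vector (Vec ℤ d) n) {r} → 0ℚ ℚ.< r →
  (∀ x → ∃[ c ] ∃[ z ] (∀ i → c i ∈[0, r ]) × (∀ j → x j ≈ linComb c u j +ℝ fromℤ (z j))) →
  CoversByTranslates (dilate (fromℚ r) (zonotope u))
covers-by-boxes u {r} 0<r covers x =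
  let c , z , c∈ , x≈ = covers x
      1/r , 0<1/r , r*1/r≡1 = positive-divides 0<r (ℚₚ.positive⁻¹ 1ℚ)
      t = fromℚ 1/r ·ᵛ c
      y = linComb t u
      rescale : ∀ j → linComb c u j ≈ fromℚ r *ℝ y j
      rescale j = ≈-sym (≈-trans (*ℝ-congˡ (fromℚ r) (linComb-· (fromℚ 1/r) c u j))
        (pointwise λ n → trans (sym (ℚₚ.*-assoc r 1/r (seq (linComb c u j) n)))
          (trans (cong (ℚ._* seq (linComb c u j) n) r*1/r≡1) (ℚₚ.*-identityˡ (seq (linComb c u j) n)))))
  in fromℚ r ·ᵛ y , tabulate z
   , (y , (t , (λ i → ∈[0,]-elim (scale-∈[0,1] 1/r 0<1/r (trans (ℚₚ.*-comm 1/r r) r*1/r≡1) (c∈ i)))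
             , λ j → unwrap (≈-refl {y j}))
        , λ j → unwrap (≈-refl {fromℚ r *ℝ y j}))
   , λ j → unwrap (≈-trans (x≈ j) (+ℝ-cong (rescale j)
       (pointwise {fromℤ (z j)} {ι (tabulate z) j} λ _ → cong (_/ 1) (sym (lookup∘tabulate z j)))))

-- Here `κ` is 1/k. Measured in multiples of the first column B₀ of `B`, the segment from `r₂` q to
-- `r₂` p has length `r₂` k, and `κ[1+η]≤r₂` makes this at least 1 + η: a full period plus the error
-- of `approximate-floor`.
module _ {n d} (u : Vector (Vec ℤ (ℕ.suc d)) n) (A B : Matrix (ℕ.suc d) (ℕ.suc d))
  (AB≡I : IsIdentity (A ⊡ B)) (BA≡I : IsIdentity (B ⊡ A))
  {p q : Vec ℤ (ℕ.suc d)} (p∈Z : ι p ∈ zonotope u) (q∈Z : ι q ∈ zonotope u)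
  {k : ℕ} (p≡q+kB₀ : ∀ j → lookup p j ≡ lookup q j ℤ.+ + k ℤ.* B j zero)
  {κ η r₁ r₂ : ℚ} (0<η : 0ℚ ℚ.< η) (0<r₁ : 0ℚ ℚ.< r₁) (0<r₂ : 0ℚ ℚ.< r₂)
  (0≤κ : 0ℚ ℚ.≤ κ) (κ*k≡1 : κ ℚ.* (+ k / 1) ≡ 1ℚ) (κ[1+η]≤r₂ : κ ℚ.* (1ℚ ℚ.+ η) ℚ.≤ r₂)
  {ρ : ℝ} (ρ-within : EventuallyWithin r₁ ρ)
  (covers : CoversByTranslates (dilate ρ (zonotope (projection A u))))
  where

  private
    A₊ = A ∘ suc
    tᵖ = proj₁ p∈Z
    tᑫ = proj₁ q∈Z

    module _ (x : Vector ℝ (ℕ.suc d)) where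
      -- The segment to be added starts at `r₂` q, so this endpoint is subtracted in advance.
      x′ : Vector ℝ (ℕ.suc d)
      x′ j = x j -ℝ fromℚ r₂ *ℝ ι q j

      cover = covers (A₊ ⊛ x′)
      y₁ = proj₁ cover
      z₁ = proj₁ (proj₂ cover)
      y₀ = proj₁ (proj₁ (proj₂ (proj₂ cover)))
      y₀∈ = proj₁ (proj₂ (proj₁ (proj₂ (proj₂ cover))))
      t = proj₁ y₀∈

      y₁≈ : ∀ i → y₁ i ≈ ρ *ℝ linComb t (projection A u) i
      y₁≈ i = ≈-trans (wrap {y₁ i} {ρ *ℝ y₀ i} (proj₂ (proj₂ (proj₁ (proj₂ (proj₂ cover)))) i))
        (*ℝ-congˡ ρ (wrap {y₀ i} {linComb t (projection A u) i} (proj₂ (proj₂ y₀∈) i)))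

      -- The covering point of the projection is lifted with the same coefficients `t`. The
      -- remainder `v` projects to the lattice point `z₁`, so it lies on a line through a lattice
      -- point in the direction of B₀.
      v : Vector ℝ (ℕ.suc d)
      v = x′ +ᵛ (-ℝ ρ) ·ᵛ linComb t u

      A₊v : ∀ i → (A₊ ⊛ v) i ≈ fromℤ (lookup z₁ i)
      A₊v i = begin
        (A₊ ⊛ v) i
          ≈⟨ ⊛-+ A₊ x′ ((-ℝ ρ) ·ᵛ linComb t u) i ⟩
        (A₊ ⊛ x′) i +ℝ (A₊ ⊛ ((-ℝ ρ) ·ᵛ linComb t u)) i
          ≈⟨ +ℝ-cong (wrap (proj₂ (proj₂ (proj₂ cover)) i)) (⊛-· A₊ (-ℝ ρ) (linComb t u) i) ⟩
        (y₁ i +ℝ ι z₁ i) +ℝ -ℝ ρ *ℝ (A₊ ⊛ linComb t u) i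
          ≈⟨ +ℝ-cong (+ℝ-cong (y₁≈ i) ≈-refl) (*ℝ-congˡ (-ℝ ρ) (≈-sym (linComb-image A₊ t u i))) ⟩
        (ρ *ℝ ℓ +ℝ ι z₁ i) +ℝ -ℝ ρ *ℝ ℓ
          ≈⟨ pointwise (λ n → solve 3 (λ ρ ℓ z → (ρ :* ℓ :+ z) :+ (con (ℚ.- 1ℚ) :* ρ) :* ℓ := z) refl
               (seq ρ n) (seq ℓ n) (seq (ι z₁ i) n)) ⟩
        ι z₁ i ∎
        where
        open SetoidReasoning ℝ-Ring.setoid
        ℓ = linComb t (projection A u) i

      -- The position of `v` along that line in multiples of B₀. Removing `a` of them leaves `v`
      -- equal to a lattice point plus `θ` B₀.
      τ = (A ⊛ v) zero
      a = proj₁ (approximate-floor τ η 0<η)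
      θ = τ -ℝ fromℤ a
      σ = fromℚ κ *ℝ θ

      σ-within : EventuallyWithin r₂ σ
      σ-within = mapᵉ
        (λ n (0≤θ , θ≤1+η) → 0≤* 0≤κ 0≤θ ,
          ℚₚ.≤-trans (ℚₚ.*-monoˡ-≤-nonNeg κ {{ℚ.nonNegative 0≤κ}} θ≤1+η) κ[1+η]≤r₂)
        (proj₂ (approximate-floor τ η 0<η))

      z₊ ζ : Vector ℤ (ℕ.suc d)
      z₊ = a ∷ᶠ lookup z₁
      ζ j = ∑ℤ.sum λ i → B j i ℤ.* z₊ i

      θ₊ : Vector ℝ (ℕ.suc d)
      θ₊ = θ ∷ᶠ 0ᵛ

      Av : ∀ i → (A ⊛ v) i ≈ ((fromℤ ∘ z₊) +ᵛ θ₊) i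
      Av zero = pointwise λ n →
        solve 2 (λ τ a → τ := a :+ (τ :+ con (ℚ.- 1ℚ) :* a)) refl (seq τ n) (seq (fromℤ a) n)
      Av (suc i) = ≈-trans (A₊v i) (≈-sym (ℝ-Ring.+-identityʳ (ι z₁ i)))

      Bθ₊ : ∀ j → (B ⊛ θ₊) j ≈ fromℤ (B j zero) *ℝ θ
      Bθ₊ j = ≈-trans (+ℝ-cong ≈-refl (⊛-zero (λ i k → B i (suc k)) j))
        (ℝ-Ring.+-identityʳ (fromℤ (B j zero) *ℝ θ))

      v≈ : ∀ j → v j ≈ fromℤ (ζ j) +ℝ fromℤ (B j zero) *ℝ θ
      v≈ j = begin
        v j                                       ≈⟨ inverse-⊛ B A BA≡I v j ⟨
        (B ⊛ (A ⊛ v)) j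
          ≈⟨ ⊛-cong B {A ⊛ v} {(fromℤ ∘ z₊) +ᵛ θ₊} Av j ⟩
        (B ⊛ ((fromℤ ∘ z₊) +ᵛ θ₊)) j              ≈⟨ ⊛-+ B (fromℤ ∘ z₊) θ₊ j ⟩
        (B ⊛ (fromℤ ∘ z₊)) j +ℝ (B ⊛ θ₊) j        ≈⟨ +ℝ-cong (⊛-fromℤ B z₊ j) (Bθ₊ j) ⟩
        fromℤ (ζ j) +ℝ fromℤ (B j zero) *ℝ θ      ∎
        where open SetoidReasoning ℝ-Ring.setoid

      -- The first summand equals `ρ` t; writing it as a combination of 0 and t of total weight `r₁`
      -- bounds it by `r₁`. The second one gives the point `r₂` q + `σ` (p - q).
      coefficients : Vector ℝ n
      coefficients i = convex r₁ ρ 0ℝ (t i) +ℝ convex r₂ σ (tᑫ i) (tᵖ i)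

      coefficients∈ : ∀ i → coefficients i ∈[0, r₁ ℚ.+ r₂ ]
      coefficients∈ i = +-∈[0,]
        (convex-∈[0,] r₁ ρ 0<r₁ ρ-within 0∈[0,1] (unit (proj₁ (proj₂ y₀∈) i)))
        (convex-∈[0,] r₂ σ 0<r₂ σ-within (unit (proj₁ (proj₂ q∈Z) i)) (unit (proj₁ (proj₂ p∈Z) i)))
        where
        unit : ∀ {x} → 0ℝ ≤ℝ x × x ≤ℝ 1ℝ → x ∈[0, 1ℚ ]
        unit (0≤x , x≤1) = ∈[0,]-intro 0≤x x≤1

      linComb-coefficients : ∀ j → linComb coefficients u j ≈
        ρ *ℝ linComb t u j +ℝ convex r₂ σ (ι q j) (ι p j)
      linComb-coefficients j = begin
        linComb coefficients u j
          ≈⟨ linComb-+ (λ i → convex r₁ ρ 0ℝ (t i)) (λ i → convex r₂ σ (tᑫ i) (tᵖ i)) u j ⟩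
        linComb (λ i → convex r₁ ρ 0ℝ (t i)) u j +ℝ linComb (λ i → convex r₂ σ (tᑫ i) (tᵖ i)) u j
          ≈⟨ +ℝ-cong (linComb-convex r₁ ρ 0ᵛ t u j) (linComb-convex r₂ σ tᑫ tᵖ u j) ⟩
        convex r₁ ρ (linComb 0ᵛ u j) (linComb t u j) +ℝ convex r₂ σ (linComb tᑫ u j) (linComb tᵖ u j)
          ≈⟨ +ℝ-cong
               (+ℝ-cong (*ℝ-congˡ (fromℚ r₁ -ℝ ρ) (linComb-zero u j)) ≈-refl)
               (+ℝ-cong (*ℝ-congˡ (fromℚ r₂ -ℝ σ) (≈-sym (wrap (proj₂ (proj₂ q∈Z) j))))
                        (*ℝ-congˡ σ (≈-sym (wrap (proj₂ (proj₂ p∈Z) j))))) ⟩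
        convex r₁ ρ 0ℝ (linComb t u j) +ℝ convex r₂ σ (ι q j) (ι p j)
          ≈⟨ +ℝ-cong (pointwise (λ n → solve 3 (λ r ρ ℓ →
               (r :+ con (ℚ.- 1ℚ) :* ρ) :* con 0ℚ :+ ρ :* ℓ := ρ :* ℓ) refl
               r₁ (seq ρ n) (seq (linComb t u j) n))) ≈-refl ⟩
        ρ *ℝ linComb t u j +ℝ convex r₂ σ (ι q j) (ι p j) ∎
        where open SetoidReasoning ℝ-Ring.setoid

      -- σ is chosen so that σ (p - q) = θ B₀.
      segment : ∀ j → convex r₂ σ (ι q j) (ι p j) ≈ fromℚ r₂ *ℝ ι q j +ℝ fromℤ (B j zero) *ℝ θ
      segment j = pointwise λ n → trans
        (cong (λ p → (r₂ ℚ.+ ℚ.- 1ℚ ℚ.* (κ ℚ.* seq θ n)) ℚ.* (lookup q j / 1) ℚ.+ (κ ℚ.* seq θ n) ℚ.* p) p/1≡)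
        (trans (rearrange r₂ κ (seq θ n) (lookup q j / 1) (+ k / 1) (B j zero / 1))
          (trans (cong (λ c → r₂ ℚ.* (lookup q j / 1) ℚ.+ c ℚ.* ((B j zero / 1) ℚ.* seq θ n)) κ*k≡1)
            (cong (r₂ ℚ.* (lookup q j / 1) ℚ.+_) (ℚₚ.*-identityˡ _))))
        where
        p/1≡ : lookup p j / 1 ≡ lookup q j / 1 ℚ.+ (+ k / 1) ℚ.* (B j zero / 1)
        p/1≡ = trans (cong (_/ 1) (p≡q+kB₀ j)) (trans (/1-+ (lookup q j) (+ k ℤ.* B j zero))
          (cong (lookup q j / 1 ℚ.+_) (/1-* (+ k) (B j zero))))
        rearrange : ∀ r κ θ q k b →
          (r ℚ.+ ℚ.- 1ℚ ℚ.* (κ ℚ.* θ)) ℚ.* q ℚ.+ (κ ℚ.* θ) ℚ.* (q ℚ.+ k ℚ.* b) ≡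
          r ℚ.* q ℚ.+ (κ ℚ.* k) ℚ.* (b ℚ.* θ)
        rearrange = solve 6 (λ r κ θ q k b →
          (r :+ con (ℚ.- 1ℚ) :* (κ :* θ)) :* q :+ (κ :* θ) :* (q :+ k :* b) :=
          r :* q :+ (κ :* k) :* (b :* θ)) refl

      x≈ : ∀ j → x j ≈ linComb coefficients u j +ℝ fromℤ (ζ j)
      x≈ j = begin
        x j
          ≈⟨ pointwise (λ n → solve 4 (λ x q ρ ℓ →
               x := ((x :+ con (ℚ.- 1ℚ) :* q) :+ (con (ℚ.- 1ℚ) :* ρ) :* ℓ) :+ (ρ :* ℓ :+ q)) refl
               (seq (x j) n) (seq qⱼ n) (seq ρ n) (seq ℓ n)) ⟩
        v j +ℝ (ρ *ℝ ℓ +ℝ qⱼ)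
          ≈⟨ +ℝ-cong (v≈ j) ≈-refl ⟩
        (fromℤ (ζ j) +ℝ fromℤ (B j zero) *ℝ θ) +ℝ (ρ *ℝ ℓ +ℝ qⱼ)
          ≈⟨ pointwise (λ n → solve 4 (λ z b m q → (z :+ b) :+ (m :+ q) := (m :+ (q :+ b)) :+ z) refl
               (seq (fromℤ (ζ j)) n) (seq (fromℤ (B j zero) *ℝ θ) n) (seq (ρ *ℝ ℓ) n) (seq qⱼ n)) ⟩
        (ρ *ℝ ℓ +ℝ (qⱼ +ℝ fromℤ (B j zero) *ℝ θ)) +ℝ fromℤ (ζ j)
          ≈⟨ +ℝ-cong (+ℝ-cong ≈-refl (≈-sym (segment j))) ≈-refl ⟩
        (ρ *ℝ ℓ +ℝ convex r₂ σ (ι q j) (ι p j)) +ℝ fromℤ (ζ j)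
          ≈⟨ +ℝ-cong (≈-sym (linComb-coefficients j)) ≈-refl ⟩
        linComb coefficients u j +ℝ fromℤ (ζ j) ∎
        where
        open SetoidReasoning ℝ-Ring.setoid
        ℓ = linComb t u j
        qⱼ = fromℚ r₂ *ℝ ι q j

  covers-from-projection : CoversByTranslates (dilate (fromℚ (r₁ ℚ.+ r₂)) (zonotope u))
  covers-from-projection = covers-by-boxes u (ℚₚ.+-mono-< 0<r₁ 0<r₂)
    λ x → coefficients x , ζ x , coefficients∈ x , x≈ x

-- The bound on the covering radius and the choice of m

1/n≤1 : ∀ n .{{_ : ℕ.NonZero n}} → + 1 / n ℚ.≤ 1ℚ
1/n≤1 n@(ℕ.suc k) = ℚₚ.*-cancelʳ-≤-pos (+ n / 1) {{ℚ.positive (0<n/1 n)}} (≤-by-difference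
  (trans (cong₂ (λ a b → 1ℚ ℚ.* a ℚ.- b) (/1-+ (+ 1) (+ k)) (a/n*n≡a (+ 1) n))
    (solve 1 (λ k → con 1ℚ :* (con 1ℚ :+ k) :+ :- (con 1ℚ) := k) refl (+ k / 1)))
  (0≤n/1 k))

0≤a/n : ∀ a n .{{_ : ℕ.NonZero n}} → 0ℚ ℚ.≤ + a / n
0≤a/n a n = ℚₚ.nonNegative⁻¹ (+ a / n) {{ℚₚ.normalize-nonNeg a n}}

-- With e = d - 1, equality holds: after clearing denominators it is e (e + 3) + 2 = (e + 1)(e + 2).
ratio-sum : ∀ e m .{{_ : ℕ.NonZero m}} → m ℕ.* 2 ≡ (3 ℕ.+ e) ℕ.* (2 ℕ.+ e) →
            + e / (2 ℕ.+ e) ℚ.+ + 1 / m ℚ.≤ + ℕ.suc e / (3 ℕ.+ e)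
ratio-sum e m 2m≡ = ℚₚ.*-cancelʳ-≤-pos (b ℚ.* a)
  {{ℚ.positive (0<* (0<n/1 (3 ℕ.+ e)) (0<n/1 (2 ℕ.+ e)))}} (ℚₚ.≤-reflexive (begin
  (X ℚ.+ g) ℚ.* (b ℚ.* a)
    ≡⟨ solve 4 (λ X g a b → (X :+ g) :* (b :* a) := (X :* a) :* b :+ g :* (b :* a)) refl X g a b ⟩
  (X ℚ.* a) ℚ.* b ℚ.+ g ℚ.* (b ℚ.* a)
    ≡⟨ cong₂ (λ x y → x ℚ.* b ℚ.+ g ℚ.* y) (a/n*n≡a (+ e) (2 ℕ.+ e)) (sym M*2≡) ⟩
  E ℚ.* b ℚ.+ g ℚ.* (M ℚ.* two)
    ≡⟨ cong (E ℚ.* b ℚ.+_) (ℚₚ.*-assoc g M two) ⟨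
  E ℚ.* b ℚ.+ (g ℚ.* M) ℚ.* two
    ≡⟨ cong₂ (λ b x → E ℚ.* b ℚ.+ x ℚ.* two) (/1-+ (+ 3) (+ e)) (a/n*n≡a (+ 1) m) ⟩
  E ℚ.* (three ℚ.+ E) ℚ.+ 1ℚ ℚ.* two
    ≡⟨ solve 1 (λ E → E :* (con three :+ E) :+ con 1ℚ :* con two := (con 1ℚ :+ E) :* (con two :+ E)) refl E ⟩
  (1ℚ ℚ.+ E) ℚ.* (two ℚ.+ E)
    ≡⟨ cong₂ ℚ._*_ (/1-+ (+ 1) (+ e)) (/1-+ (+ 2) (+ e)) ⟨
  (+ ℕ.suc e / 1) ℚ.* a
    ≡⟨ cong (ℚ._* a) (a/n*n≡a (+ ℕ.suc e) (3 ℕ.+ e)) ⟨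
  (Y ℚ.* b) ℚ.* a                               ≡⟨ ℚₚ.*-assoc Y b a ⟩
  Y ℚ.* (b ℚ.* a)                               ∎))
  where
  open ≡-Reasoning
  X = + e / (2 ℕ.+ e)
  Y = + ℕ.suc e / (3 ℕ.+ e)
  g = + 1 / m
  E = + e / 1
  M = + m / 1
  a = + (2 ℕ.+ e) / 1
  b = + (3 ℕ.+ e) / 1
  two = + 2 / 1
  three = + 3 / 1
  M*2≡ : M ℚ.* two ≡ b ℚ.* a
  M*2≡ = begin
    M ℚ.* two                          ≡⟨ /1-* (+ m) (+ 2) ⟨
    (+ m ℤ.* + 2) / 1                  ≡⟨ cong (_/ 1) (ℤₚ.pos-* m 2) ⟨
    + (m ℕ.* 2) / 1                    ≡⟨ cong (λ k → + k / 1) 2m≡ ⟩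
    + ((3 ℕ.+ e) ℕ.* (2 ℕ.+ e)) / 1    ≡⟨ cong (_/ 1) (ℤₚ.pos-* (3 ℕ.+ e) (2 ℕ.+ e)) ⟩
    (+ (3 ℕ.+ e) ℤ.* + (2 ℕ.+ e)) / 1  ≡⟨ /1-* (+ (3 ℕ.+ e)) (+ (2 ℕ.+ e)) ⟩
    b ℚ.* a                            ∎

covering-radius-bound : ∀ {d n} (u : Vector (Vec ℤ (ℕ.suc d)) n) → Cosimple u →
  ∀ c → 0ℚ ℚ.≤ c →
  (∀ (w : Vector (Vec ℤ d) n) → Cosimple w → ∃[ μ ] IsCoveringRadius (zonotope w) μ × μ ≤ℝ fromℚ c) →
  ∀ m .{{_ : ℕ.NonZero m}} {p q} → ι p ∈ zonotope u → ι q ∈ zonotope u → p ≢ q →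
  residue m p ≡ residue m q →
  ∀ μ → IsCoveringRadius (zonotope u) μ → μ ≤ℝ fromℚ (c ℚ.+ + 1 / m)
covering-radius-bound {d} u cosimple c 0≤c bound m {p} {q} p∈Z q∈Z p≢q p≡q[m] μ isRadius ε 0<ε =
  mapᵉ (λ n μ≤ → ℚₚ.≤-trans μ≤ (ℚₚ.≤-reflexive (total c g ε)))
    (proj₁ isRadius (fromℚ (r₁ ℚ.+ r₂)) (0<R , R-covers) ε′ 0<ε′)
  where
  -- A quarter of ε: `r₁` uses two of them, for the choice of `ρ` and for the bound on the projected
  -- covering radius, `r₂` uses one, and the comparison of μ with a covering factor uses the last.
  ε′ = ½ ℚ.* (½ ℚ.* ε)
  0<ε′ = 0<* 0<½ (0<* 0<½ 0<ε)
  total : ∀ c g ε → c ℚ.+ (½ ℚ.* (½ ℚ.* ε) ℚ.+ ½ ℚ.* (½ ℚ.* ε)) ℚ.+ (g ℚ.+ ½ ℚ.* (½ ℚ.* ε)) ℚ.+ ½ ℚ.* (½ ℚ.* ε)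
    ≡ c ℚ.+ g ℚ.+ ε
  total = solve 3 (λ c g ε → c :+ (con ½ :* (con ½ :* ε) :+ con ½ :* (con ½ :* ε)) :+
    (g :+ con ½ :* (con ½ :* ε)) :+ con ½ :* (con ½ :* ε) := c :+ g :+ ε) refl

  g = + 1 / m
  0≤g = 0≤a/n 1 m
  r₁ = c ℚ.+ (ε′ ℚ.+ ε′)
  r₂ = g ℚ.+ ε′
  0<r₁ = ℚₚ.+-mono-≤-< 0≤c (ℚₚ.+-mono-< 0<ε′ 0<ε′)
  0<r₂ = ℚₚ.+-mono-≤-< 0≤g 0<ε′

  p-q/m = quotient-difference m p q
  open UnimodularCompletion (completion p-q/m)

  content-nonZero : ℕ.NonZero content
  content-nonZero = ℕ.≢-nonZero λ content≡0 → p≢q (begin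
    p                    ≡⟨ tabulate∘lookup p ⟨
    tabulate (lookup p)  ≡⟨ tabulate-cong (λ j → same j content≡0) ⟩
    tabulate (lookup q)  ≡⟨ tabulate∘lookup q ⟩
    q                    ∎)
    where
    open ≡-Reasoning
    same : ∀ j → content ≡ 0 → lookup p j ≡ lookup q j
    same j content≡0 = begin
      lookup p j                                         ≡⟨ residue-≡ m p q p≡q[m] j ⟩
      lookup q j ℤ.+ + m ℤ.* p-q/m j
        ≡⟨ cong (λ z → lookup q j ℤ.+ + m ℤ.* z) (multiple j) ⟩
      lookup q j ℤ.+ + m ℤ.* (+ content ℤ.* B j zero)
        ≡⟨ cong (λ k → lookup q j ℤ.+ + m ℤ.* (+ k ℤ.* B j zero)) content≡0 ⟩
      lookup q j ℤ.+ + m ℤ.* 0ℤ                          ≡⟨ cong (ℤ._+_ (lookup q j)) (ℤₚ.*-zeroʳ (+ m)) ⟩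
      lookup q j ℤ.+ 0ℤ                                  ≡⟨ ℤₚ.+-identityʳ (lookup q j) ⟩
      lookup q j                                         ∎

  instance _ = content-nonZero

  k = m ℕ.* content
  p≡q+kB₀ : ∀ j → lookup p j ≡ lookup q j ℤ.+ + k ℤ.* B j zero
  p≡q+kB₀ j = begin
    lookup p j                                         ≡⟨ residue-≡ m p q p≡q[m] j ⟩
    lookup q j ℤ.+ + m ℤ.* p-q/m j
      ≡⟨ cong (λ z → lookup q j ℤ.+ + m ℤ.* z) (multiple j) ⟩
    lookup q j ℤ.+ + m ℤ.* (+ content ℤ.* B j zero)
      ≡⟨ cong (ℤ._+_ (lookup q j)) (ℤₚ.*-assoc (+ m) (+ content) (B j zero)) ⟨
    lookup q j ℤ.+ + m ℤ.* + content ℤ.* B j zero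
      ≡⟨ cong (λ z → lookup q j ℤ.+ z ℤ.* B j zero) (ℤₚ.pos-* m content) ⟨
    lookup q j ℤ.+ + k ℤ.* B j zero                    ∎
    where open ≡-Reasoning

  h = + 1 / content
  κ = g ℚ.* h
  0≤h = 0≤a/n 1 content
  κ*k≡1 : κ ℚ.* (+ k / 1) ≡ 1ℚ
  κ*k≡1 = begin
    κ ℚ.* (+ k / 1)                              ≡⟨ cong (λ z → κ ℚ.* (z / 1)) (ℤₚ.pos-* m content) ⟩
    κ ℚ.* ((+ m ℤ.* + content) / 1)              ≡⟨ cong (κ ℚ.*_) (/1-* (+ m) (+ content)) ⟩
    g ℚ.* h ℚ.* ((+ m / 1) ℚ.* (+ content / 1))
      ≡⟨ solve 4 (λ g h m k → g :* h :* (m :* k) := (g :* m) :* (h :* k)) refl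
           g h (+ m / 1) (+ content / 1) ⟩
    (g ℚ.* (+ m / 1)) ℚ.* (h ℚ.* (+ content / 1))
      ≡⟨ cong₂ ℚ._*_ (a/n*n≡a (+ 1) m) (a/n*n≡a (+ 1) content) ⟩
    1ℚ                                           ∎
    where open ≡-Reasoning

  -- Since the content is at least 1, κ = g h is at most g, and also at most 1; the two terms of κ +
  -- κ ε′ are compared with g and ε′ separately.
  κ[1+ε′]≤r₂ : κ ℚ.* (1ℚ ℚ.+ ε′) ℚ.≤ r₂
  κ[1+ε′]≤r₂ = ≤-by-difference
    (solve 3 (λ g h ε → g :+ ε :+ :- (g :* h :* (con 1ℚ :+ ε)) :=
      g :* (con 1ℚ :+ :- h) :+ ε :* ((con 1ℚ :+ :- g) :+ g :* (con 1ℚ :+ :- h))) refl g h ε′)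
    (0≤+ (0≤* 0≤g 0≤1-h) (0≤* (ℚₚ.<⇒≤ 0<ε′) (0≤+ (p≤q⇒0≤q-p (1/n≤1 m)) (0≤* 0≤g 0≤1-h))))
    where 0≤1-h = p≤q⇒0≤q-p (1/n≤1 content)

  projected = bound (projection A u) (projection-cosimple A B AB≡I cosimple)
  -- The infimum itself may fail to be a covering factor: in dimension 0 it is 0, while factors must
  -- be positive. Hence a factor `ρ` slightly above it.
  nearby = proj₂ (proj₁ (proj₂ projected)) (fromℚ ε′)
    (ε′ , 0<ε′ , always λ _ → ℚₚ.≤-reflexive (ℚₚ.+-identityˡ ε′))
  ρ = proj₁ nearby

  ρ-within : EventuallyWithin r₁ ρ
  ρ-within =
    let (δ₁ , 0<δ₁ , 0<ρ) , _ = proj₁ (proj₂ nearby)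
        δ₂ , 0<δ₂ , ρ<μ+ε = proj₂ (proj₂ nearby)
    in mapᵉ (λ n (0+δ₁≤ρ , ρ+δ₂≤μ+ε , μ≤c+ε) →
         ℚₚ.≤-trans (ℚₚ.<⇒≤ (ℚₚ.+-mono-≤-< ℚₚ.≤-refl 0<δ₁)) 0+δ₁≤ρ
       , ≤-by-difference
           (solve 5 (λ c ε ρ μ δ → c :+ (ε :+ ε) :+ :- ρ :=
             (μ :+ ε :+ :- (ρ :+ δ)) :+ ((c :+ ε :+ :- μ) :+ δ)) refl
             c ε′ (seq ρ n) (seq (proj₁ projected) n) δ₂)
           (0≤+ (p≤q⇒0≤q-p ρ+δ₂≤μ+ε) (0≤+ (p≤q⇒0≤q-p μ≤c+ε) (ℚₚ.<⇒≤ 0<δ₂))))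
       (0<ρ ∧ᵉ (ρ<μ+ε ∧ᵉ proj₂ (proj₂ projected) ε′ 0<ε′))

  R-covers : CoversByTranslates (dilate (fromℚ (r₁ ℚ.+ r₂)) (zonotope u))
  R-covers = covers-from-projection u A B AB≡I BA≡I {p} {q} p∈Z q∈Z {k} p≡q+kB₀
    0<ε′ 0<r₁ 0<r₂ (0≤* 0≤g 0≤h) κ*k≡1 κ[1+ε′]≤r₂ {ρ} ρ-within (proj₂ (proj₁ (proj₂ nearby)))

  0<R : 0ℝ <ℝ fromℚ (r₁ ℚ.+ r₂)
  0<R = r₁ ℚ.+ r₂ , ℚₚ.+-mono-< 0<r₁ 0<r₂ , always λ _ → ℚₚ.≤-reflexive (ℚₚ.+-identityˡ (r₁ ℚ.+ r₂))

<ℝ⇒≱ℝ : ∀ {x y} → x <ℝ y → ¬ y ≤ℝ x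
<ℝ⇒≱ℝ {x} {y} (δ , 0<δ , x+δ≤y) y≤x =
  let n , x+δ≤yₙ , y≤x+ε = eventually⇒witness (x+δ≤y ∧ᵉ y≤x (½ ℚ.* δ) (0<* 0<½ 0<δ))
  in ℚₚ.<-irrefl refl (ℚₚ.<-≤-trans (0<* 0<½ 0<δ) (≤-by-difference
       (solve 3 (λ x y δ → con 0ℚ :+ :- (con ½ :* δ) :=
         (y :+ :- (x :+ δ)) :+ (x :+ con ½ :* δ :+ :- y)) refl (seq x n) (seq y n) δ)
       (0≤+ (p≤q⇒0≤q-p x+δ≤yₙ) (p≤q⇒0≤q-p y≤x+ε))))

≤ℝ-fromℚ-mono : ∀ {x p q} → p ℚ.≤ q → x ≤ℝ fromℚ p → x ≤ℝ fromℚ q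
≤ℝ-fromℚ-mono p≤q x≤p ε 0<ε = mapᵉ (λ n x≤p+ε → ℚₚ.≤-trans x≤p+ε (ℚₚ.+-monoˡ-≤ ε p≤q)) (x≤p ε 0<ε)

theorem3 : ∀ (d : ℕ) → 1 ≤ d →
    (∀ (n : ℕ) (u : Vector (Vec ℤ (d ∸ 1)) n) → Cosimple u →
    ∃[ μ ] IsCoveringRadius (zonotope u) μ × μ ≤ℝ fromℚ (+ (d ∸ 1) / (1 + d))) →
    ∀ (n : ℕ) (u : Vector (Vec ℤ d) n) → Cosimple u →
    ∀ (μ : ℝ) → IsCoveringRadius (zonotope u) μ → fromℚ (+ d / (2 + d)) <ℝ μ →
    AtMost (((d + 2) C 2) ^ d) (λ (p : Vec ℤ d) → ι p ∈ zonotope u)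
theorem3 (ℕ.suc e) _ smaller n u cosimple μ isRadius large xs xs! xs⊆Z = ℕₚ.≮⇒≥ λ m^d<∣xs∣ →
  let p , q , p∈Z , q∈Z , p≢q , p≡q[m] = congruent-pair m xs xs! xs⊆Z m^d<∣xs∣
  in <ℝ⇒≱ℝ {fromℚ (+ ℕ.suc e / (3 + e))} {μ} large (≤ℝ-fromℚ-mono {μ} (ratio-sum e m 2m≡)
       (covering-radius-bound u cosimple (+ e / (2 + e)) (0≤a/n e (2 + e)) (smaller n)
         m {p} {q} p∈Z q∈Z p≢q p≡q[m] μ isRadius))
  where
  m = (ℕ.suc e + 2) C 2
  2m≡ : m ℕ.* 2 ≡ (3 + e) ℕ.* (2 + e)
  -- `ℕ.suc e + 2` computes to `ℕ.suc (e + 2)`, hence the index e + 2; commutativity then matches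
  -- the denominators `2 + e` and `3 + e`.
  2m≡ = trans ([1+n]C2*2≡[1+n]*n (e + 2)) (cong (λ k → ℕ.suc k ℕ.* k) (ℕₚ.+-comm e 2))
  instance
    m-nonZero : ℕ.NonZero m
    m-nonZero = ℕ.≢-nonZero λ m≡0 → ℕₚ.0≢1+n (trans (sym (cong (ℕ._* 2) m≡0)) 2m≡)
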